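{- There is an algorithm that, given a size-$N$ instance $\mathcal{S}$ of $(k,k')$-Set-Cover with $n$ sets and a parameter $\ell\le N$, runs in $\mathrm{poly}(N)$ time and outputs a circuit representation of a function $f:(\{0,1\}^\ell)^n\to\{0,1\}$ and a generator for a distribution $\mathcal{D}$ over $(\{0,1\}^\ell)^n$ satisfying: (i) If $\mathrm{opt}(\mathcal{S})\le k$, then $f$ is a $k\ell$-junta under $\mathcal{D}$. (ii) If $\mathrm{opt}(\mathcal{S})>k'$, then any DNF of size $\le \exp(O(k'\ell))$ is $\Omega(\frac{1}{N})$-far from $f$ under $\mathcal{D}$.
   Context: Set cover: an instance of size $N$ is a bipartite graph $\mathcal{S}=(S,U,E)$ on $N$ vertices, where $S$ is the collection of sets ($n=|S|$) and $U$ is the universe; a set cover is a subset $C\subseteq S$ such that every vertex of $U$ is adjacent to some vertex of $C$, and $\mathrm{opt}(\mathcal{S})$ is the minimum size of a set cover. The $(k,k')$-Set-Cover problem: given $\mathcal{S}$ and $k,k'\in\mathbb{N}$, output Yes if $\mathrm{opt}(\mathcal{S})\le k$ and No if $\mathrm{opt}(\mathcal{S})>k'$. The parameter $\ell$ is a positive integer. Conventions. The $O(\cdot)$ and $\Omega(\cdot)$ in (ii) hide absolute positive constants: that is, there are absolute constants $c_1,c_2>0$ such that any DNF of size at most $\exp(c_1k'\ell)$ is $\frac{c_2}{N}$-far from $f$ under $\mathcal{D}$. $\mathrm{dist}_{\mathcal{D}}(f,g)=\Pr_{x\sim\mathcal{D}}[f(x)\neq g(x)]$; $f$ is $\varepsilon$-far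 from $g$ under $\mathcal{D}$ if $\mathrm{dist}_{\mathcal{D}}(f,g)>\varepsilon$. A $k$-junta is a function whose output depends on at most $k$ input bits; "$f$ is a $k$-junta under $\mathcal{D}$" means some $k$-junta $g$ has $\mathrm{dist}_{\mathcal{D}}(g,f)=0$. A DNF formula is a disjunction of terms, each term being a conjunction of literals (variables or their negations); its size is its number of terms. Circuits have AND, OR, NOT and PARITY gates. A generator for a distribution over $M$-bit strings is an algorithm mapping $M$ uniform random bits to $M$ bits with that distribution.
   Formalization: Part (ii) is stated for ℓ ≥ 2: at ℓ = 1 it fails, e.g. for one set covering one element with k = k' = 0, where f is a function of one bit and so has a DNF with at most one term. Instances are assumed to have a set cover, so that opt is defined. -}

module Defs where

open import Data.Bool.Base using (Bool; true; false; not; if_then_else_; _xor_)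
open import Data.Bool.ListAction using (and; or; any; all)
open import Data.Fin.Base using (Fin; zero; suc; toℕ)
open import Data.Fin.Subset using (Subset; _∈_; ∣_∣)
open import Data.Integer.Base using (+_)
import Data.Integer.Base as ℤ
open import Data.List.Base using (List; []; _∷_; map; _++_; length; filterᵇ; foldr)
import Data.List.Base as List
open import Data.Nat.Base using (ℕ; zero; suc; _+_; _*_; _^_; _≤_)
open import Data.Nat.Properties using (m^n≢0)
open import Data.Product.Base using (_×_; _,_; ∃; ∃-syntax; Σ-syntax)
open import Data.Rational.Unnormalised.Base using (ℚᵘ; 0ℚᵘ; _≃_; _/_; ↥_; ↧ₙ_)
import Data.Rational.Unnormalised.Base as ℚ
open import Data.Vec.Base using (Vec; []; _∷_; lookup; _∷ʳ_; _[_]≔_; replicate; head)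
import Data.Vec.Base as Vec
open import Relation.Binary.PropositionalEquality using (_≡_)

------------------------------------------------------------------------
-- Model of computation: a WHILE language over binary trees.
--
-- Storing or passing a value costs its size, so no value (in particular
-- no output) can outgrow the running time through sharing.  With this
-- charge, running times agree with those of Turing machines up to a
-- polynomial in running time and input length.

data Tree : Set where
  nil : Tree
  _∙_ : Tree → Tree → Tree

infixr 5 _∙_

size : Tree → ℕ
size nil     = 1
size (a ∙ b) = suc (size a + size b)

left right : Tree → Tree
left nil      = nil
left (a ∙ _)  = a
right nil     = nil
right (_ ∙ b) = b

data Exp (m : ℕ) : Set where
  var   : Fin m → Exp m
  nil   : Exp m
  cons  : Exp m → Exp m → Exp m
  hd tl : Exp m → Exp m

Store : ℕ → Set
Store m = Vec Tree m

⟦_⟧ᵉ : ∀ {m} → Exp m → Store m → Tree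
⟦ var i ⟧ᵉ    σ = lookup σ i
⟦ nil ⟧ᵉ      σ = nil
⟦ cons d e ⟧ᵉ σ = ⟦ d ⟧ᵉ σ ∙ ⟦ e ⟧ᵉ σ
⟦ hd e ⟧ᵉ     σ = left (⟦ e ⟧ᵉ σ)
⟦ tl e ⟧ᵉ     σ = right (⟦ e ⟧ᵉ σ)

-- A callee is a subterm of the calling command, so calls are never
-- recursive: they are inlined code working on fresh registers.
data Cmd (m : ℕ) : Set where
  skip  : Cmd m
  _≔_   : Fin m → Exp m → Cmd m
  call  : Fin m → ∀ {r} → Cmd (suc r) → Exp m → Cmd m
  _⨾_   : Cmd m → Cmd m → Cmd m
  cond  : Exp m → Cmd m → Cmd m → Cmd m
  while : Exp m → Cmd m → Cmd m

infix  6 _≔_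
infixr 5 _⨾_

initial : ∀ {r} → Tree → Store (suc r)
initial {r} x = x ∷ replicate r nil

-- c ⊢ σ ⇓ σ′ [ t ]: started in σ, the command c halts in σ′ after time t.
-- As a condition, nil is false and every other tree is true.
data _⊢_⇓_[_] : ∀ {m} → Cmd m → Store m → Store m → ℕ → Set where
  skip : ∀ {m} {σ : Store m} → skip ⊢ σ ⇓ σ [ 1 ]

  assign : ∀ {m} {σ : Store m} {i e} →
    (i ≔ e) ⊢ σ ⇓ (σ [ i ]≔ ⟦ e ⟧ᵉ σ) [ suc (size (⟦ e ⟧ᵉ σ)) ]

  call : ∀ {m r} {σ : Store m} {i e} {c : Cmd (suc r)} {y ρ t} →
    c ⊢ initial (⟦ e ⟧ᵉ σ) ⇓ (y ∷ ρ) [ t ] →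
    call i c e ⊢ σ ⇓ (σ [ i ]≔ y) [ suc (size (⟦ e ⟧ᵉ σ) + t + size y) ]

  seq : ∀ {m} {σ σ′ σ″ : Store m} {c d t t′} →
    c ⊢ σ ⇓ σ′ [ t ] → d ⊢ σ′ ⇓ σ″ [ t′ ] →
    (c ⨾ d) ⊢ σ ⇓ σ″ [ t + t′ ]

  cond-true : ∀ {m} {σ σ′ : Store m} {e c d a b t} →
    ⟦ e ⟧ᵉ σ ≡ a ∙ b → c ⊢ σ ⇓ σ′ [ t ] →
    cond e c d ⊢ σ ⇓ σ′ [ suc t ]

  cond-false : ∀ {m} {σ σ′ : Store m} {e c d t} →
    ⟦ e ⟧ᵉ σ ≡ nil → d ⊢ σ ⇓ σ′ [ t ] →
    cond e c d ⊢ σ ⇓ σ′ [ suc t ]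

  while-true : ∀ {m} {σ σ′ σ″ : Store m} {e c a b t t′} →
    ⟦ e ⟧ᵉ σ ≡ a ∙ b → c ⊢ σ ⇓ σ′ [ t ] → while e c ⊢ σ′ ⇓ σ″ [ t′ ] →
    while e c ⊢ σ ⇓ σ″ [ suc (t + t′) ]

  while-false : ∀ {m} {σ : Store m} {e c} →
    ⟦ e ⟧ᵉ σ ≡ nil →
    while e c ⊢ σ ⇓ σ [ 1 ]

Runs : ∀ {r} → Cmd (suc r) → Tree → Tree → ℕ → Set
Runs p x y t = ∃[ ρ ] p ⊢ initial x ⇓ (y ∷ ρ) [ t ]

unary : ℕ → Tree
unary zero    = nil
unary (suc n) = nil ∙ unary n

encodeBool : Bool → Tree
encodeBool b = if b then nil ∙ nil else nil

encodeList : List Tree → Tree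
encodeList = foldr _∙_ nil

------------------------------------------------------------------------
-- Set cover

-- The vertex set of the bipartite graph is Fin #sets ⊎ Fin #elems.  The
-- field coverable says that some set cover exists, i.e. that the minimum
-- defining opt is over a nonempty collection.
record Instance : Set where
  field
    #sets #elems : ℕ
    adj          : Fin #sets → Fin #elems → Bool
    coverable    : ∀ u → ∃[ s ] adj s u ≡ true

open Instance public

∣V∣ : Instance → ℕ
∣V∣ S = #sets S + #elems S

IsCover : (S : Instance) → Subset (#sets S) → Set
IsCover S C = ∀ u → ∃[ s ] s ∈ C × adj S s u ≡ true

-- IsOpt S o: opt(S) = o.
IsOpt : Instance → ℕ → Set
IsOpt S o = (∃[ C ] IsCover S C × ∣ C ∣ ≡ o) × (∀ C → IsCover S C → o ≤ ∣ C ∣)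

-- The graph is given by its adjacency matrix, one row per element of U.
encodeInstance : Instance → Tree
encodeInstance S = unary (#sets S) ∙ unary (#elems S) ∙ encodeList (List.tabulate row)
  where
  row : Fin (#elems S) → Tree
  row u = encodeList (List.tabulate λ s → encodeBool (adj S s u))

encodeInput : Instance → (k k′ ℓ : ℕ) → Tree
encodeInput S k k′ ℓ = encodeInstance S ∙ unary ℓ ∙ unary k ∙ unary k′

------------------------------------------------------------------------
-- Circuits

Bits : ℕ → Set
Bits M = Vec Bool M

data Gate (w : ℕ) : Set where
  AND OR PARITY : List (Fin w) → Gate w
  NOT           : Fin w → Gate w

-- Straight-line form: Gates M w has w wires, of which the first M are the
-- inputs; each further wire is the output of a gate reading earlier wires.
data Gates (M : ℕ) : ℕ → Set where
  inputs : Gates M M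
  _▷_    : ∀ {w} → Gates M w → Gate w → Gates M (suc w)

infixl 5 _▷_

record Circuit (M K : ℕ) : Set where
  constructor circuit
  field
    {wires} : ℕ
    gates   : Gates M wires
    outputs : Vec (Fin wires) K

evalGate : ∀ {w} → Gate w → Bits w → Bool
evalGate (AND is)    v = and (map (lookup v) is)
evalGate (OR is)     v = or (map (lookup v) is)
evalGate (PARITY is) v = foldr _xor_ false (map (lookup v) is)
evalGate (NOT i)     v = not (lookup v i)

evalGates : ∀ {M w} → Gates M w → Bits M → Bits w
evalGates inputs  x = x
evalGates (c ▷ g) x = let v = evalGates c x in v ∷ʳ evalGate g v

eval : ∀ {M K} → Circuit M K → Bits M → Bits K
eval (circuit c os) x = Vec.map (lookup (evalGates c x)) os

eval₁ : ∀ {M} → Circuit M 1 → Bits M → Bool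
eval₁ c x = head (eval c x)

encodeWire : ∀ {w} → Fin w → Tree
encodeWire i = unary (toℕ i)

encodeGate : ∀ {w} → Gate w → Tree
encodeGate (AND is)    = unary 0 ∙ encodeList (map encodeWire is)
encodeGate (OR is)     = unary 1 ∙ encodeList (map encodeWire is)
encodeGate (PARITY is) = unary 2 ∙ encodeList (map encodeWire is)
encodeGate (NOT i)     = unary 3 ∙ encodeWire i

-- The list of gates, last gate first.
encodeGates : ∀ {M w} → Gates M w → Tree
encodeGates inputs  = nil
encodeGates (c ▷ g) = encodeGate g ∙ encodeGates c

encodeCircuit : ∀ {M K} → Circuit M K → Tree
encodeCircuit (circuit c os) =
  encodeGates c ∙ encodeList (map encodeWire (Vec.toList os))

encodeOutput : ∀ {M} → Circuit M 1 → Circuit M M → Tree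
encodeOutput f G = encodeCircuit f ∙ encodeCircuit G

------------------------------------------------------------------------
-- Distance under the distribution of a generator

cube : ∀ M → List (Bits M)
cube zero    = [] ∷ []
cube (suc M) = map (true ∷_) (cube M) ++ map (false ∷_) (cube M)

-- Probability of an event under uniform M-bit strings.
Pr : ∀ {M} → (Bits M → Bool) → ℚᵘ
Pr {M} A = (+ length (filterᵇ A (cube M))) / (2 ^ M)
  where instance _ = m^n≢0 2 M

-- A distribution D is given by a generator G : D is the law of G applied
-- to a uniform string.
dist : ∀ {M} → (Bits M → Bits M) → (f g : Bits M → Bool) → ℚᵘ
dist G f g = Pr λ r → f (G r) xor g (G r)

Far : ∀ {M} → (Bits M → Bits M) → ℚᵘ → (f g : Bits M → Bool) → Set
Far G ε f g = dist G f g ℚ.> ε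

Junta : ∀ {M} → ℕ → (Bits M → Bool) → Set
Junta {M} q g = Σ[ J ∈ Subset M ] ∣ J ∣ ≤ q ×
  (∀ x y → (∀ i → i ∈ J → lookup x i ≡ lookup y i) → g x ≡ g y)

JuntaUnder : ∀ {M} → (Bits M → Bits M) → ℕ → (Bits M → Bool) → Set
JuntaUnder G q f = ∃[ g ] Junta q g × dist G g f ≃ 0ℚᵘ

------------------------------------------------------------------------
-- DNF formulas

data Literal (M : ℕ) : Set where
  pos neg : Fin M → Literal M

Term : ℕ → Set
Term M = List (Literal M)

DNF : ℕ → Set
DNF M = List (Term M)

evalLiteral : ∀ {M} → Bits M → Literal M → Bool
evalLiteral x (pos i) = lookup x i
evalLiteral x (neg i) = not (lookup x i)

evalDNF : ∀ {M} → DNF M → Bits M → Bool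
evalDNF φ x = any (all (evalLiteral x)) φ

-- s ≤ 2^(c·x) for a positive rational c = a/b, written as s^b ≤ 2^(a·x).
-- Base 2 in place of e only rescales the constant c by ln 2.
AtMostExp : ℕ → ℚᵘ → ℕ → Set
AtMostExp s c x = s ^ ↧ₙ c ≤ 2 ^ (ℤ.∣ ↥ c ∣ * x)

{-# OPTIONS --safe #-}
module Submission where

-- With ℓ = suc l, the seed bit (s , 0) of each block is a selector; the
-- selector bits w encode either nothing or an element u, and the generator
-- outputs (s , suc j) ↦ r (s , suc j) and at (s , 0) the bit that gives
-- block s the parity adj s u (even parity for all blocks if no element is
-- encoded).  The function f says that all blocks are even, so the blocks of
-- any cover decide it under D.
--
-- For hardness, let a term T accept an all-even output.  For a column
-- j ≥ 1 let C be the set of blocks s with T mentioning (s , j).  If C is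
-- not a cover, some u is not covered, and flipping (s , j) for all s
-- containing u gives an output of the part of u that T still accepts,
-- although f is false there.  As each part has mass at least 1/(2N), a DNF
-- with small error accepts all-even outputs mostly through terms for which
-- most columns have more than k′ blocks; such terms have at least
-- (k′ + 1)ℓ/2 free literals and hence exponentially small acceptance
-- probability.
--
-- The reduction is programmed in a class of tree functions that is closed
-- under composition, case distinction and bounded recursion and consists of
-- polynomial time functions.

open import Defs
open import Data.Bool.Base using (Bool; true; false; not; if_then_else_; _xor_; _∧_; _∨_; T)
open import Data.Bool.ListAction using (and; or; any; all)
open import Data.Bool.Properties using (T-≡; T?; xor-assoc; xor-comm; xor-same; xor-identityʳ; _≟_; ¬-not)
open import Data.Empty using (⊥-elim; ⊥-elim-irr)
open import Data.Fin.Base using (Fin; zero; suc; toℕ; inject₁; fromℕ; fromℕ<; cast; combine; remQuot; _↑ˡ_; _↑ʳ_)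
open import Data.Fin.Properties
  using (toℕ-inject₁; toℕ-fromℕ; toℕ-fromℕ<; toℕ-cast; toℕ-↑ʳ; toℕ-injective; toℕ<n; toℕ-combine; remQuot-combine; combine-remQuot; any?; ¬∀⟶∃¬)
  renaming (_≟_ to _≟ᶠ_)
open import Data.Fin.Relation.Unary.Top using (view; ‵fromℕ; ‵inject₁)
open import Data.Fin.Subset using (Subset; ∣_∣; _∈_)
import Data.Integer.Base as ℤ
import Data.Integer.Properties as ℤ
open import Data.List.Base as List using (List; []; _∷_; [_]; map; _++_; _∷ʳ_; _ʳ++_; reverse; concat; tabulate; foldr; length; filterᵇ)
import Data.List.Membership.Propositional as List
open import Data.List.Membership.Propositional.Properties
import Data.List.Properties as List
open import Data.List.Relation.Unary.All as All using ([]; _∷_)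
open import Data.List.Relation.Unary.AllPairs using ([]; _∷_)
open import Data.List.Relation.Unary.Any using (here; there)
open import Data.List.Relation.Unary.Unique.Propositional using (Unique)
import Data.List.Relation.Unary.Unique.Propositional.Properties as Unique
open import Data.Nat.Base using (ℕ; zero; suc; _+_; _*_; _^_; _≤_; _<_; _≤ᵇ_; _<ᵇ_; z≤n; s≤s; s≤s⁻¹; NonZero; >-nonZero)
open import Data.Nat.Properties hiding (_≟_)
open import Data.Nat.Tactic.RingSolver using (solve-∀)
open import Data.Product.Base using (_×_; _,_; proj₁; proj₂; ∃-syntax; Σ-syntax; uncurry)
open import Data.Rational.Unnormalised.Base using (ℚᵘ; 0ℚᵘ; mkℚᵘ; _/_; _≃_; *≡*; *<*)
import Data.Rational.Unnormalised.Base as ℚ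
open import Data.Sum.Base using (_⊎_; inj₁; inj₂)
open import Data.Vec.Base as Vec using (Vec; []; _∷_; lookup)
import Data.Vec.Properties as Vec
open import Data.Vec.Relation.Binary.Pointwise.Extensional using (Pointwise-≡⇒≡; ext)
open import Function.Base using (_∘_)
open import Function.Bundles using (Equivalence)
open import Relation.Binary.PropositionalEquality hiding ([_])
open import Relation.Nullary using (¬_; does; yes; no)
open import Relation.Nullary.Decidable using (_×-dec_)
open import Algebra.Properties.CommutativeMonoid.Sum +-0-commutativeMonoid using (sum; ∑-distrib-+; ∑-comm; sum-cong-≗)

-- Polynomial time functions on trees

-- The generator gets no seed bits beyond the `M` bits that it outputs. Prescribing the parity of a
-- block makes one of its output bits redundant, and this frees the seed bit at position 0 to act as
-- a selector. Terms are accordingly measured only on the free columns `suc j`. The uncovered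
-- element depends on the seed through the accepting term, so distinct all-even seeds might be moved
-- to the same error. For a fixed column the move can be undone: the selectors of the moved seed
-- reveal the neighbourhood of the element, hence the flipped bits. Different columns may still
-- reach the same error, so seeds are charged column by column and the charges averaged. At most
-- half of the all-even seeds are accepted through wide terms, and at most twice as many as there
-- are errors through the other terms; hence all-even seeds number at most six times the errors.
-- With mass at least 1/(2N) for the all-even part, the error is at least 1/(12N), and strictness
-- turns 12 into 13.

data Poly : Set where
  X         : Poly
  K         : ℕ → Poly
  _⊕_ _⊗_   : Poly → Poly → Poly
  _∘ₚ_      : Poly → Poly → Poly

infixl 6 _⊕_
infixl 7 _⊗_
infixl 8 _∘ₚ_

evalPoly : Poly → ℕ → ℕ
evalPoly X       n = n
evalPoly (K c)   n = c
evalPoly (p ⊕ q) n = evalPoly p n + evalPoly q n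
evalPoly (p ⊗ q) n = evalPoly p n * evalPoly q n
evalPoly (p ∘ₚ q) n = evalPoly p (evalPoly q n)

evalPoly-mono : ∀ p {m n} → m ≤ n → evalPoly p m ≤ evalPoly p n
evalPoly-mono X       m≤n = m≤n
evalPoly-mono (K c)   m≤n = ≤-refl
evalPoly-mono (p ⊕ q) m≤n = +-mono-≤ (evalPoly-mono p m≤n) (evalPoly-mono q m≤n)
evalPoly-mono (p ⊗ q) m≤n = *-mono-≤ (evalPoly-mono p m≤n) (evalPoly-mono q m≤n)
evalPoly-mono (p ∘ₚ q) m≤n = evalPoly-mono p (evalPoly-mono q m≤n)

[m*n]^k≡m^k*n^k : ∀ m n k → (m * n) ^ k ≡ m ^ k * n ^ k
[m*n]^k≡m^k*n^k m n zero    = refl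
[m*n]^k≡m^k*n^k m n (suc k) =
  trans (cong (m * n *_) ([m*n]^k≡m^k*n^k m n k)) ([m*n]*[o*p]≡[m*o]*[n*p] m n (m ^ k) (n ^ k))

-- Restricting to `1 ≤ n` allows the exponents of both summands to be raised to a common one.
-- Composite costs are kept symbolic and expanded only here.
monomial-bound : ∀ p → ∃[ a ] ∃[ d ] (∀ n → 1 ≤ n → evalPoly p n ≤ a * n ^ d)
monomial-bound X = 1 , 1 , λ n _ → ≤-reflexive (sym (trans (*-identityˡ _) (*-identityʳ _)))
monomial-bound (K c) = c , 0 , λ n _ → ≤-reflexive (sym (*-identityʳ c))
monomial-bound (p ⊕ q) with monomial-bound p | monomial-bound q
... | a , d , hp | b , e , hq = a + b , d + e , λ { n@(suc _) 1≤n → begin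
  evalPoly p n + evalPoly q n            ≤⟨ +-mono-≤ (hp n 1≤n) (hq n 1≤n) ⟩
  a * n ^ d + b * n ^ e                  ≤⟨ +-mono-≤ (*-monoʳ-≤ a (^-monoʳ-≤ n (m≤m+n d e)))
                                                      (*-monoʳ-≤ b (^-monoʳ-≤ n (m≤n+m e d))) ⟩
  a * n ^ (d + e) + b * n ^ (d + e)      ≡⟨ *-distribʳ-+ (n ^ (d + e)) a b ⟨
  (a + b) * n ^ (d + e) ∎ }
  where open ≤-Reasoning
monomial-bound (p ⊗ q) with monomial-bound p | monomial-bound q
... | a , d , hp | b , e , hq = a * b , d + e , λ n 1≤n → begin
  evalPoly p n * evalPoly q n            ≤⟨ *-mono-≤ (hp n 1≤n) (hq n 1≤n) ⟩
  (a * n ^ d) * (b * n ^ e)              ≡⟨ [m*n]*[o*p]≡[m*o]*[n*p] a (n ^ d) b (n ^ e) ⟩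
  (a * b) * (n ^ d * n ^ e)              ≡⟨ cong ((a * b) *_) (^-distribˡ-+-* n d e) ⟨
  (a * b) * n ^ (d + e) ∎
  where open ≤-Reasoning
monomial-bound (p ∘ₚ q) with monomial-bound p | monomial-bound q
-- `suc b` in place of `b` makes the inner bound at least 1, as the induction hypothesis for `p`
-- requires.
... | a , d , hp | b , e , hq = a * suc b ^ d , e * d , λ { n@(suc _) 1≤n → begin
  evalPoly p (evalPoly q n)              ≤⟨ evalPoly-mono p (≤-trans (hq n 1≤n) (*-monoˡ-≤ (n ^ e) (n≤1+n b))) ⟩
  evalPoly p (suc b * n ^ e)             ≤⟨ hp _ (*-mono-≤ {1} {suc b} (s≤s z≤n) (m^n>0 n e)) ⟩
  a * (suc b * n ^ e) ^ d                ≡⟨ cong (a *_) ([m*n]^k≡m^k*n^k (suc b) (n ^ e) d) ⟩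
  a * (suc b ^ d * (n ^ e) ^ d)          ≡⟨ *-assoc a (suc b ^ d) ((n ^ e) ^ d) ⟨
  a * suc b ^ d * (n ^ e) ^ d            ≡⟨ cong (a * suc b ^ d *_) (^-*-assoc n e d) ⟩
  a * suc b ^ d * n ^ (e * d) ∎ }
  where open ≤-Reasoning

-- The same polynomial bounds time and output size. The size bound makes composition possible:
-- passing a value is charged its size, and the time of the next program is measured in it.
record Fun : Set where
  field
    ⟦_⟧   : Tree → Tree
    {aux} : ℕ
    prog  : Cmd (suc aux)
    cost  : Poly
    runs  : ∀ x → ∃[ t ] Runs prog x (⟦_⟧ x) t × t ≤ evalPoly cost (size x)
    small : ∀ x → size (⟦_⟧ x) ≤ evalPoly cost (size x)

open Fun

computed : (f : Tree → Tree) → ∀ {aux} (p : Cmd (suc aux)) (time out : Poly) →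
           (∀ x → ∃[ t ] Runs p x (f x) t × t ≤ evalPoly time (size x)) →
           (∀ x → size (f x) ≤ evalPoly out (size x)) → Fun
computed f p time out r s = record
  { ⟦_⟧ = f ; prog = p ; cost = time ⊕ out
  ; runs = λ x → let t , ρ , t≤ = r x in t , ρ , m≤n⇒m≤n+o (evalPoly out (size x)) t≤
  ; small = λ x → m≤n⇒m≤o+n (evalPoly time (size x)) (s x) }

1≤size : ∀ x → 1 ≤ size x
1≤size nil     = s≤s z≤n
1≤size (_ ∙ _) = s≤s z≤n

size-left : ∀ x → size (left x) ≤ size x
size-left nil     = ≤-refl
size-left (a ∙ b) = m≤n⇒m≤1+n (m≤m+n (size a) (size b))

size-right : ∀ x → size (right x) ≤ size x
size-right nil     = ≤-refl
size-right (a ∙ b) = m≤n⇒m≤1+n (m≤n+m (size b) (size a))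

idF : Fun
idF = record
  { ⟦_⟧ = λ x → x ; prog = skip {1} ; cost = X
  ; runs = λ x → 1 , ([] , skip) , 1≤size x ; small = λ x → ≤-refl }

expF : (e : Exp 1) (p : Poly) → (∀ x → size (⟦ e ⟧ᵉ (x ∷ [])) ≤ evalPoly p (size x)) → Fun
expF e p h = record
  { ⟦_⟧ = λ x → ⟦ e ⟧ᵉ (x ∷ []) ; prog = zero ≔ e ; cost = K 1 ⊕ p
  ; runs = λ x → _ , ([] , assign) , s≤s (h x)
  ; small = λ x → m≤n⇒m≤1+n (h x) }

nilF leftF rightF : Fun
nilF   = expF nil (K 1) λ _ → ≤-refl
leftF  = expF (hd (var zero)) X size-left
rightF = expF (tl (var zero)) X size-right

infixr 9 _∘F_

_∘F_ : Fun → Fun → Fun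
g ∘F f = computed (λ x → ⟦ g ⟧ (⟦ f ⟧ x))
  (call {1} zero (prog f) (var zero) ⨾ call zero (prog g) (var zero))
  (K 1 ⊕ X ⊕ F ⊕ F ⊕ (K 1 ⊕ F ⊕ G ⊕ G)) G
  (λ x →
    let t₁ , (_ , r₁) , b₁ = runs f x
        t₂ , (_ , r₂) , b₂ = runs g (⟦ f ⟧ x)
        fx = small f x
        up = evalPoly-mono (cost g) fx
    in _ , (_ , seq (call r₁) (call r₂)) ,
       +-mono-≤ (s≤s (+-mono-≤ (+-monoʳ-≤ (size x) b₁) fx))
                (s≤s (+-mono-≤ (+-mono-≤ fx (≤-trans b₂ up))
                               (≤-trans (small g _) up))))
  (λ x → ≤-trans (small g _) (evalPoly-mono (cost g) (small f x)))
  where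
  F G : Poly
  F = cost f
  G = cost g ∘ₚ cost f

pairF : Fun → Fun → Fun
pairF f g = computed (λ x → ⟦ f ⟧ x ∙ ⟦ g ⟧ x)
  (call {3} i₁ (prog f) (var zero) ⨾ call i₂ (prog g) (var zero) ⨾ zero ≔ cons (var i₁) (var i₂))
  (K 1 ⊕ X ⊕ F ⊕ F ⊕ (K 1 ⊕ X ⊕ G ⊕ G ⊕ (K 2 ⊕ F ⊕ G))) (K 1 ⊕ F ⊕ G)
  (λ x →
    let t₁ , (_ , r₁) , b₁ = runs f x
        t₂ , (_ , r₂) , b₂ = runs g x
    in _ , (_ , seq (call r₁) (seq (call r₂) assign)) ,
       +-mono-≤ (s≤s (+-mono-≤ (+-monoʳ-≤ (size x) b₁) (small f x)))
       (+-mono-≤ (s≤s (+-mono-≤ (+-monoʳ-≤ (size x) b₂) (small g x)))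
                 (s≤s (s≤s (+-mono-≤ (small f x) (small g x))))))
  (λ x → s≤s (+-mono-≤ (small f x) (small g x)))
  where
  F G : Poly
  F = cost f
  G = cost g
  i₁ i₂ : Fin 3
  i₁ = suc zero
  i₂ = suc (suc zero)

branch : Tree → Tree → Tree → Tree
branch nil     y z = z
branch (_ ∙ _) y z = y

ifF : Fun → Fun → Fun → Fun
ifF c f g = computed (λ x → branch (⟦ c ⟧ x) (⟦ f ⟧ x) (⟦ g ⟧ x)) code total (F ⊕ G) go out
  where
  C F G : Poly
  C = cost c
  F = cost f
  G = cost g
  i₁ : Fin 2
  i₁ = suc zero
  code : Cmd 2
  code = call i₁ (prog c) (var zero) ⨾ cond (var i₁) (call zero (prog f) (var zero)) (call zero (prog g) (var zero))
  total : Poly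
  total = K 1 ⊕ X ⊕ C ⊕ C ⊕ (K 2 ⊕ X ⊕ (F ⊕ G) ⊕ (F ⊕ G))
  F≤ : ∀ n → evalPoly F n ≤ evalPoly (F ⊕ G) n
  F≤ n = m≤m+n _ _
  G≤ : ∀ n → evalPoly G n ≤ evalPoly (F ⊕ G) n
  G≤ n = m≤n+m _ _
  out : ∀ x → size (branch (⟦ c ⟧ x) (⟦ f ⟧ x) (⟦ g ⟧ x)) ≤ evalPoly (F ⊕ G) (size x)
  out x with ⟦ c ⟧ x
  ... | nil   = ≤-trans (small g x) (G≤ _)
  ... | _ ∙ _ = ≤-trans (small f x) (F≤ _)
  go : ∀ x → ∃[ t ] Runs code x (branch (⟦ c ⟧ x) (⟦ f ⟧ x) (⟦ g ⟧ x)) t × t ≤ evalPoly total (size x)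
  go x with ⟦ c ⟧ x | runs c x | small c x
  ... | nil | _ , (_ , r₁) , b₁ | s₁ =
    let _ , (_ , r₂) , b₂ = runs g x in
    _ , (_ , seq (call r₁) (cond-false refl (call r₂))) ,
    +-mono-≤ (s≤s (+-mono-≤ (+-monoʳ-≤ (size x) b₁) s₁))
      (s≤s (s≤s (+-mono-≤ (+-monoʳ-≤ (size x) (≤-trans b₂ (G≤ _))) (≤-trans (small g x) (G≤ _)))))
  ... | _ ∙ _ | _ , (_ , r₁) , b₁ | s₁ =
    let _ , (_ , r₂) , b₂ = runs f x in
    _ , (_ , seq (call r₁) (cond-true refl (call r₂))) ,
    +-mono-≤ (s≤s (+-mono-≤ (+-monoʳ-≤ (size x) b₁) s₁))
      (s≤s (s≤s (+-mono-≤ (+-monoʳ-≤ (size x) (≤-trans b₂ (F≤ _))) (≤-trans (small f x) (F≤ _)))))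

-- A step sees the environment, the state and the whole remaining list, so it can use the tail as
-- well as the head.
iter : (Tree → Tree) → Tree → Tree → Tree → Tree
iter h e s nil     = s
iter h e s (a ∙ l) = iter h e (h (e ∙ s ∙ a ∙ l)) l

-- Bounded recursion: a state that grows additively in each round keeps
-- polynomial size.
iterF : (h : Fun) (q : Poly) →
        (∀ e s l → size (⟦ h ⟧ (e ∙ s ∙ l)) ≤ size s + evalPoly q (size (e ∙ l))) →
        Fun → Fun → Fun
iterF h q grow f g = computed (λ x → iter ⟦ h ⟧ x (⟦ f ⟧ x) (⟦ g ⟧ x))
  (call {3} i₁ (prog f) (var zero) ⨾ call i₂ (prog g) (var zero) ⨾
   while (var i₂) body ⨾ zero ≔ var i₁)
  (K 1 ⊕ X ⊕ F ⊕ F ⊕ (K 1 ⊕ X ⊕ G ⊕ G ⊕ (K 1 ⊕ G ⊗ C ⊕ (K 1 ⊕ S)))) S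
  (λ x →
      let _ , (_ , r₁) , b₁ = runs f x
          _ , (_ , r₂) , b₂ = runs g x
          _ , r₃ , b₃ = loop x (⟦ f ⟧ x) (⟦ g ⟧ x) (start x) (small g x)
      in _ , (_ , seq (call r₁) (seq (call r₂) (seq r₃ assign))) ,
         +-mono-≤ (s≤s (+-mono-≤ (+-monoʳ-≤ (size x) b₁) (small f x)))
         (+-mono-≤ (s≤s (+-mono-≤ (+-monoʳ-≤ (size x) b₂) (small g x)))
         (+-mono-≤ (≤-trans b₃ (s≤s (*-monoˡ-≤ (evalPoly C (size x)) (small g x))))
                   (s≤s (final x (⟦ f ⟧ x) (⟦ g ⟧ x) (start x) (small g x))))))
  (λ x → final x (⟦ f ⟧ x) (⟦ g ⟧ x) (start x) (small g x))
  where
  i₁ i₂ : Fin 3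
  i₁ = suc zero
  i₂ = suc (suc zero)
  body : Cmd 3
  body = call i₁ (prog h) (cons (var zero) (cons (var i₁) (var i₂))) ⨾ i₂ ≔ tl (var i₂)
  F G S Q I C : Poly
  F = cost f
  G = cost g
  -- `Q` bounds the growth in one round, `S` every intermediate state, `I` the argument of the step,
  -- and `C` the time of one round.
  Q = q ∘ₚ (K 1 ⊕ X ⊕ G)
  S = F ⊕ G ⊗ Q
  I = K 1 ⊕ X ⊕ (K 1 ⊕ S ⊕ G)
  C = K 1 ⊕ (K 1 ⊕ I ⊕ cost h ∘ₚ I ⊕ S ⊕ (K 1 ⊕ G))
  module _ (x : Tree) where
    n : ℕ
    n = size x
    -- A potential: each node of the remaining list holds a credit of `Q`, which pays for the growth
    -- of the state when the node is consumed.
    Room : Tree → Tree → Set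
    Room s l = size s + size l * evalPoly Q n ≤ evalPoly S n
    start : Room (⟦ f ⟧ x) (⟦ g ⟧ x)
    start = +-mono-≤ (small f x) (*-monoˡ-≤ (evalPoly Q n) (small g x))
    next : ∀ s a l → Room s (a ∙ l) → size (a ∙ l) ≤ evalPoly G n → Room (⟦ h ⟧ (x ∙ s ∙ a ∙ l)) l
    next s a l room al≤ = begin
      size (⟦ h ⟧ (x ∙ s ∙ a ∙ l)) + size l * Qn    ≤⟨ +-monoˡ-≤ (size l * Qn) (grow x s (a ∙ l)) ⟩
      size s + evalPoly q (size (x ∙ a ∙ l)) + size l * Qn
        ≤⟨ +-monoˡ-≤ (size l * Qn) (+-monoʳ-≤ (size s) (evalPoly-mono q (s≤s (+-monoʳ-≤ n al≤)))) ⟩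
      size s + Qn + size l * Qn                     ≡⟨ +-assoc (size s) Qn (size l * Qn) ⟩
      size s + suc (size l) * Qn                    ≤⟨ +-monoʳ-≤ (size s) (*-monoˡ-≤ Qn (s≤s (m≤n+m (size l) (size a)))) ⟩
      size s + size (a ∙ l) * Qn                    ≤⟨ room ⟩
      evalPoly S n ∎
      where
      open ≤-Reasoning
      Qn = evalPoly Q n
    tail≤ : ∀ a l → size (a ∙ l) ≤ evalPoly G n → size l ≤ evalPoly G n
    tail≤ a l = ≤-trans (size-right (a ∙ l))
    final : ∀ s l → Room s l → size l ≤ evalPoly G n → size (iter ⟦ h ⟧ x s l) ≤ evalPoly S n
    final s nil     room l≤ = ≤-trans (m≤m+n (size s) _) room
    final s (a ∙ l) room l≤ = final _ l (next s a l room l≤) (tail≤ a l l≤)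
    loop : ∀ s l → Room s l → size l ≤ evalPoly G n →
           ∃[ t ] while (var i₂) body ⊢ x ∷ s ∷ l ∷ [] ⇓ (x ∷ iter ⟦ h ⟧ x s l ∷ nil ∷ []) [ t ]
                  × t ≤ 1 + size l * evalPoly C n
    loop s nil     room l≤ = _ , while-false refl , s≤s z≤n
    loop s (a ∙ l) room l≤ =
      let y = x ∙ s ∙ a ∙ l
          s≤ = ≤-trans (m≤m+n (size s) _) room
          y≤ : size y ≤ evalPoly I n
          y≤ = s≤s (+-monoʳ-≤ n (s≤s (+-mono-≤ s≤ l≤)))
          room′ = next s a l room l≤
          l′≤ = tail≤ a l l≤
          _ , (_ , r) , b = runs h y
          _ , rs , bs = loop (⟦ h ⟧ y) l room′ l′≤
      in _ , while-true refl (seq (call r) assign) rs , s≤s (begin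
        _ ≤⟨ +-mono-≤ (+-mono-≤ (s≤s (+-mono-≤ (+-mono-≤ y≤ (≤-trans b (evalPoly-mono (cost h) y≤)))
                                                (≤-trans (m≤m+n _ _) room′)))
                                 (s≤s l′≤)) bs ⟩
        c + (1 + size l * suc c)     ≡⟨ +-suc c (size l * suc c) ⟩
        suc c + size l * suc c       ≤⟨ *-monoˡ-≤ (suc c) (s≤s (m≤n+m (size l) (size a))) ⟩
        size (a ∙ l) * suc c ∎)
      where
      open ≤-Reasoning
      c : ℕ
      c = evalPoly (K 1 ⊕ I ⊕ cost h ∘ₚ I ⊕ S ⊕ (K 1 ⊕ G)) n

-- Lists and unary arithmetic by bounded recursion

envF stateF restF : Fun
envF   = leftF
stateF = leftF ∘F rightF
restF  = rightF ∘F rightF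

pushF : Fun
pushF = pairF (leftF ∘F restF) stateF

size-iter-push : ∀ e s l → size (iter ⟦ pushF ⟧ e s l) ≤ size s + size l
size-iter-push e s nil     = m≤m+n (size s) 1
size-iter-push e s (a ∙ l) = ≤-trans (size-iter-push e (a ∙ s) l)
  (≤-reflexive (rearrange (size a) (size s) (size l)))
  where
  rearrange : ∀ a s l → suc (a + s) + l ≡ s + suc (a + l)
  rearrange = solve-∀

iter-push : ∀ e xs ys → iter ⟦ pushF ⟧ e (encodeList ys) (encodeList xs) ≡ encodeList (xs ʳ++ ys)
iter-push e []       ys = refl
iter-push e (x ∷ xs) ys = iter-push e xs (x ∷ ys)

push-grow : ∀ e s l → size (⟦ pushF ⟧ (e ∙ s ∙ l)) ≤ size s + size (e ∙ l)
push-grow e s l = begin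
  suc (size (left l) + size s)      ≤⟨ s≤s (+-monoˡ-≤ (size s) (size-left l)) ⟩
  suc (size l + size s)             ≡⟨ +-comm (suc (size l)) (size s) ⟩
  size s + suc (size l)             ≤⟨ +-monoʳ-≤ (size s) (s≤s (m≤n+m (size l) (size e))) ⟩
  size s + suc (size e + size l)    ∎
  where open ≤-Reasoning

abstract
  reverseOntoF : Fun → Fun → Fun
  reverseOntoF ys xs = iterF pushF X push-grow ys xs

  reverseF : Fun → Fun
  reverseF xs = reverseOntoF nilF xs

  reverseF-correct : ∀ f {e} xs → ⟦ f ⟧ e ≡ encodeList xs → ⟦ reverseF f ⟧ e ≡ encodeList (reverse xs)
  reverseF-correct f {e} xs eq rewrite eq = iter-push e xs []

  appendF : Fun → Fun → Fun
  appendF xs ys = reverseOntoF ys (reverseF xs)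

  appendF-correct : ∀ f g {e} xs ys → ⟦ f ⟧ e ≡ encodeList xs → ⟦ g ⟧ e ≡ encodeList ys →
                    ⟦ appendF f g ⟧ e ≡ encodeList (xs ++ ys)
  appendF-correct f g {e} xs ys eq eq′ =
    trans (cong₂ (iter ⟦ pushF ⟧ e) eq′ (reverseF-correct f xs eq))
    (trans (iter-push e (reverse xs) ys) (cong encodeList
      (trans (List.ʳ++-defn (reverse xs)) (cong (_++ ys) (List.reverse-involutive xs)))))

  -- `iterF` demands additive growth of the state, and in `concatStepF` the state is the second
  -- argument. The polynomial `cost` of `appendF` would be too weak for this.
  appendF-size : ∀ f g e → size (⟦ appendF f g ⟧ e) ≤ size (⟦ g ⟧ e) + suc (size (⟦ f ⟧ e))
  appendF-size f g e = ≤-trans (size-iter-push e (⟦ g ⟧ e) (⟦ reverseF f ⟧ e))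
    (+-monoʳ-≤ (size (⟦ g ⟧ e)) (size-iter-push e nil (⟦ f ⟧ e)))

concatStepF : Fun
concatStepF = appendF (leftF ∘F restF) stateF

concatStep-grow : ∀ e s l → size (⟦ concatStepF ⟧ (e ∙ s ∙ l)) ≤ size s + suc (size (e ∙ l))
concatStep-grow e s l = begin
  size (⟦ concatStepF ⟧ (e ∙ s ∙ l))  ≤⟨ appendF-size (leftF ∘F restF) stateF (e ∙ s ∙ l) ⟩
  size s + suc (size (left l))        ≤⟨ +-monoʳ-≤ (size s) (s≤s (size-left l)) ⟩
  size s + suc (size l)               ≤⟨ +-monoʳ-≤ (size s) (s≤s (size-right (e ∙ l))) ⟩
  size s + suc (size (e ∙ l))         ∎
  where open ≤-Reasoning

abstract
  concatF : Fun → Fun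
  concatF xss = iterF concatStepF (K 1 ⊕ X) concatStep-grow nilF (reverseF xss)

  concatF-correct : ∀ f {e} xss → ⟦ f ⟧ e ≡ encodeList (map encodeList xss) →
                    ⟦ concatF f ⟧ e ≡ encodeList (concat xss)
  concatF-correct f {e} xss eq = trans (cong (iter ⟦ concatStepF ⟧ e nil) (reverseF-correct f {e} (map encodeList xss) eq))
    (trans (cong (λ l → iter ⟦ concatStepF ⟧ e nil (encodeList l)) (sym (List.reverse-map encodeList xss)))
    (trans (go (reverse xss) [])
      (cong encodeList (trans (cong (λ l → concat l ++ []) (List.reverse-involutive xss)) (List.++-identityʳ _)))))
    where
    go : ∀ yss zs → iter ⟦ concatStepF ⟧ e (encodeList zs) (encodeList (map encodeList yss))
         ≡ encodeList (concat (reverse yss) ++ zs)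
    go []         zs = refl
    go (ys ∷ yss) zs =
      trans (cong (λ s → iter ⟦ concatStepF ⟧ e s (encodeList (map encodeList yss)))
                  (appendF-correct (leftF ∘F restF) stateF {e ∙ encodeList zs ∙ encodeList ys ∙ encodeList (map encodeList yss)} ys zs refl refl))
      (trans (go yss (ys ++ zs)) (cong encodeList (begin
        concat (reverse yss) ++ (ys ++ zs)                ≡⟨ List.++-assoc (concat (reverse yss)) ys zs ⟨
        (concat (reverse yss) ++ ys) ++ zs                ≡⟨ cong (λ l → (concat (reverse yss) ++ l) ++ zs) (List.++-identityʳ ys) ⟨
        (concat (reverse yss) ++ concat [ ys ]) ++ zs     ≡⟨ cong (_++ zs) (List.concat-++ (reverse yss) [ ys ]) ⟩
        concat (reverse yss ++ [ ys ]) ++ zs              ≡⟨ cong (λ l → concat l ++ zs) (List.unfold-reverse ys yss) ⟨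
        concat (reverse (ys ∷ yss)) ++ zs                 ∎)))
      where open ≡-Reasoning

-- The body receives the element in front of the environment, so nested loops extend the bindings
-- like nested binders.
mapStepF : Fun → Fun
mapStepF b = pairF (b ∘F pairF (leftF ∘F restF) envF) stateF

mapStep-grow : ∀ b e s l → size (⟦ mapStepF b ⟧ (e ∙ s ∙ l)) ≤ size s + suc (evalPoly (cost b) (size (e ∙ l)))
mapStep-grow b e s l = begin
  suc (size (⟦ b ⟧ (left l ∙ e)) + size s)     ≤⟨ s≤s (+-monoˡ-≤ (size s) (small b (left l ∙ e))) ⟩
  suc (evalPoly (cost b) (size (left l ∙ e)) + size s)
    ≤⟨ s≤s (+-monoˡ-≤ (size s) (evalPoly-mono (cost b) (s≤s (≤-trans (+-monoˡ-≤ (size e) (size-left l))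
                                                                   (≤-reflexive (+-comm (size l) (size e))))))) ⟩
  suc (evalPoly (cost b) (size (e ∙ l)) + size s)   ≡⟨ +-comm (suc _) (size s) ⟩
  size s + suc (evalPoly (cost b) (size (e ∙ l)))   ∎
  where open ≤-Reasoning

abstract
  mapF : Fun → Fun → Fun
  mapF b xs = reverseF (iterF (mapStepF b) (K 1 ⊕ cost b) (mapStep-grow b) nilF xs)

  mapF-correct : ∀ b f {e} xs → ⟦ f ⟧ e ≡ encodeList xs →
                 ⟦ mapF b f ⟧ e ≡ encodeList (map (λ a → ⟦ b ⟧ (a ∙ e)) xs)
  mapF-correct b f {e} xs eq = trans (reverseF-correct (iterF (mapStepF b) (K 1 ⊕ cost b) (mapStep-grow b) nilF f) (reverse (map h xs)) (loops eq))
    (cong encodeList (List.reverse-involutive (map h xs)))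
    where
    h : Tree → Tree
    h a = ⟦ b ⟧ (a ∙ e)
    go : ∀ xs zs → iter ⟦ mapStepF b ⟧ e (encodeList zs) (encodeList xs) ≡ encodeList (map h xs ʳ++ zs)
    go []       zs = refl
    go (x ∷ xs) zs = go xs (h x ∷ zs)
    loops : ⟦ f ⟧ e ≡ encodeList xs → iter ⟦ mapStepF b ⟧ e nil (⟦ f ⟧ e) ≡ encodeList (reverse (map h xs))
    loops eq rewrite eq = go xs []

  mapF-tabulate : ∀ b f {e k} (g h : Fin k → Tree) → ⟦ f ⟧ e ≡ encodeList (tabulate g) →
                  (∀ i → ⟦ b ⟧ (g i ∙ e) ≡ h i) → ⟦ mapF b f ⟧ e ≡ encodeList (tabulate h)
  mapF-tabulate b f {e} g h eq body = trans (mapF-correct b f (tabulate g) eq) (cong encodeList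
    (trans (List.map-tabulate g (λ a → ⟦ b ⟧ (a ∙ e))) (List.tabulate-cong body)))

tabulate-∷ʳ : ∀ {a} {A : Set a} {k} (g : Fin (suc k) → A) → tabulate g ≡ tabulate (g ∘ inject₁) ∷ʳ g (fromℕ k)
tabulate-∷ʳ {k = zero}  g = refl
tabulate-∷ʳ {k = suc k} g = cong (g zero ∷_) (tabulate-∷ʳ (g ∘ suc))

upTo : ∀ k → List Tree
upTo k = tabulate {n = k} (unary ∘ toℕ)

upTo-∷ʳ : ∀ k → upTo (suc k) ≡ upTo k ∷ʳ unary k
upTo-∷ʳ k = trans (tabulate-∷ʳ (unary ∘ toℕ)) (cong₂ (λ l x → l ∷ʳ unary x)
  (List.tabulate-cong (λ i → cong unary (toℕ-inject₁ i))) (toℕ-fromℕ k))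

-- The tails of a unary number are the smaller unary numbers. They are met in decreasing order, so
-- pushing them yields an increasing list.
tailStepF : Fun
tailStepF = pairF (rightF ∘F restF) stateF

tailStep-grow : ∀ e s l → size (⟦ tailStepF ⟧ (e ∙ s ∙ l)) ≤ size s + size (e ∙ l)
tailStep-grow e s l = begin
  suc (size (right l) + size s)     ≤⟨ s≤s (+-monoˡ-≤ (size s) (size-right l)) ⟩
  suc (size l + size s)             ≡⟨ +-comm (suc (size l)) (size s) ⟩
  size s + suc (size l)             ≤⟨ +-monoʳ-≤ (size s) (s≤s (m≤n+m (size l) (size e))) ⟩
  size s + suc (size e + size l)    ∎
  where open ≤-Reasoning

abstract
  upToF : Fun → Fun
  upToF k = iterF tailStepF X tailStep-grow nilF k

  upToF-correct : ∀ f {e} k → ⟦ f ⟧ e ≡ unary k → ⟦ upToF f ⟧ e ≡ encodeList (upTo k)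
  upToF-correct f {e} k eq rewrite eq = trans (go k []) (cong encodeList (List.++-identityʳ (upTo k)))
    where
    go : ∀ k zs → iter ⟦ tailStepF ⟧ e (encodeList zs) (unary k) ≡ encodeList (upTo k ++ zs)
    go zero    zs = refl
    go (suc k) zs = trans (go k (unary k ∷ zs)) (cong encodeList
      (trans (sym (List.++-assoc (upTo k) [ unary k ] zs)) (cong (_++ zs) (sym (upTo-∷ʳ k)))))

  tabulateF : Fun → Fun → Fun
  tabulateF b k = mapF b (upToF k)

  tabulateF-correct : ∀ b f {e k} (h : Fin k → Tree) → ⟦ f ⟧ e ≡ unary k →
                      (∀ i → ⟦ b ⟧ (unary (toℕ i) ∙ e) ≡ h i) → ⟦ tabulateF b f ⟧ e ≡ encodeList (tabulate h)
  tabulateF-correct b f h eq body = mapF-tabulate b (upToF f) _ h (upToF-correct f _ eq) body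

sucF : Fun → Fun
sucF f = pairF nilF f

abstract
  addF : Fun → Fun → Fun
  addF f g = iterF (sucF stateF) (K 2) grow g f
    where
    grow : ∀ (e s l : Tree) → 2 + size s ≤ size s + 2
    grow e s l = ≤-reflexive (+-comm 2 (size s))

  iter-suc : ∀ e m n → iter ⟦ sucF stateF ⟧ e (unary n) (unary m) ≡ unary (m + n)
  iter-suc e zero    n = refl
  iter-suc e (suc m) n = trans (iter-suc e m (suc n)) (cong unary (+-suc m n))

  size-iter-suc : ∀ e s l → size (iter ⟦ sucF stateF ⟧ e s l) ≤ size s + 2 * size l
  size-iter-suc e s nil     = m≤m+n (size s) 2
  size-iter-suc e s (a ∙ l) = begin
    size (iter ⟦ sucF stateF ⟧ e (nil ∙ s) l)  ≤⟨ size-iter-suc e (nil ∙ s) l ⟩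
    2 + size s + 2 * size l                    ≡⟨ rearrange (size s) (size l) ⟩
    size s + 2 * suc (size l)                  ≤⟨ +-monoʳ-≤ (size s) (*-monoʳ-≤ 2 (s≤s (m≤n+m (size l) (size a)))) ⟩
    size s + 2 * suc (size a + size l)         ∎
    where
    open ≤-Reasoning
    rearrange : ∀ s l → 2 + s + 2 * l ≡ s + 2 * suc l
    rearrange = solve-∀

  addF-size : ∀ f g e → size (⟦ addF f g ⟧ e) ≤ size (⟦ g ⟧ e) + 2 * size (⟦ f ⟧ e)
  addF-size f g e = size-iter-suc e (⟦ g ⟧ e) (⟦ f ⟧ e)

  addF-correct : ∀ f g {e} m n → ⟦ f ⟧ e ≡ unary m → ⟦ g ⟧ e ≡ unary n → ⟦ addF f g ⟧ e ≡ unary (m + n)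
  addF-correct f g {e} m n eq eq′ rewrite eq | eq′ = iter-suc e m n

mulStepF : Fun → Fun
mulStepF g = addF (g ∘F envF) stateF

mulStep-grow : ∀ g e s l → size (⟦ mulStepF g ⟧ (e ∙ s ∙ l)) ≤ size s + 2 * evalPoly (cost g) (size (e ∙ l))
mulStep-grow g e s l = ≤-trans (addF-size (g ∘F envF) stateF (e ∙ s ∙ l))
  (+-monoʳ-≤ (size s) (*-monoʳ-≤ 2 (≤-trans (small g e) (evalPoly-mono (cost g) (size-left (e ∙ l))))))

abstract
  mulF : Fun → Fun → Fun
  mulF f g = iterF (mulStepF g) (K 2 ⊗ cost g) (mulStep-grow g) nilF f

  mulF-correct : ∀ f g {e} m n → ⟦ f ⟧ e ≡ unary m → ⟦ g ⟧ e ≡ unary n → ⟦ mulF f g ⟧ e ≡ unary (m * n)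
  mulF-correct f g {e} m n eq eq′ rewrite eq = trans (go m 0) (cong unary (+-identityʳ (m * n)))
    where
    go : ∀ m k → iter ⟦ mulStepF g ⟧ e (unary k) (unary m) ≡ unary (m * n + k)
    go zero    k = refl
    go (suc m) k = trans (cong (λ s → iter ⟦ mulStepF g ⟧ e s (unary m))
                               (addF-correct (g ∘F envF) stateF {e ∙ unary k ∙ unary (suc m)} n k eq′ refl))
      (trans (go m (n + k)) (cong unary (trans (sym (+-assoc (m * n) n k)) (cong (_+ k) (+-comm (m * n) n)))))

drop : ℕ → Tree → Tree
drop zero    l = l
drop (suc k) l = drop k (right l)

abstract
  dropF : Fun → Fun → Fun
  dropF k xs = iterF (rightF ∘F stateF) (K 0) grow xs k
    where
    grow : ∀ (e s l : Tree) → size (right s) ≤ size s + 0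
    grow e s l = ≤-trans (size-right s) (m≤m+n (size s) 0)

  dropF-correct : ∀ f g {e} k → ⟦ f ⟧ e ≡ unary k → ⟦ dropF f g ⟧ e ≡ drop k (⟦ g ⟧ e)
  dropF-correct f g {e} k eq rewrite eq = go k (⟦ g ⟧ e)
    where
    go : ∀ k s → iter ⟦ rightF ∘F stateF ⟧ e s (unary k) ≡ drop k s
    go zero    s = refl
    go (suc k) s = go k (right s)

atF : Fun → Fun → Fun
atF k xs = leftF ∘F dropF k xs

left-drop-tabulate : ∀ {k} (g : Fin k → Tree) i → left (drop (toℕ i) (encodeList (tabulate g))) ≡ g i
left-drop-tabulate g zero    = refl
left-drop-tabulate g (suc i) = left-drop-tabulate (g ∘ suc) i

atF-tabulate : ∀ f xs {e k} (i : Fin k) (g : Fin k → Tree) → ⟦ f ⟧ e ≡ unary (toℕ i) →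
               ⟦ xs ⟧ e ≡ encodeList (tabulate g) → ⟦ atF f xs ⟧ e ≡ g i
atF-tabulate f xs i g eq eq′ = trans (cong left (trans (dropF-correct f xs (toℕ i) eq) (cong (drop (toℕ i)) eq′)))
  (left-drop-tabulate g i)

-- Binary numerals

-- Least significant bit first.
inc : List Bool → List Bool
inc []          = true ∷ []
inc (false ∷ l) = true ∷ l
inc (true ∷ l)  = false ∷ inc l

bin : ℕ → List Bool
bin zero    = []
bin (suc n) = inc (bin n)

encodeBits : List Bool → Tree
encodeBits l = encodeList (map encodeBool l)

-- The state consists of the carry and the reversed output.
carryF : Fun
carryF = ifF c (ifF b (pairF c (pairF nilF out)) (pairF nilF (pairF (pairF nilF nilF) out)))
               (pairF nilF (pairF b out))
  where
  c b out : Fun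
  c   = leftF ∘F stateF
  b   = leftF ∘F restF
  out = rightF ∘F stateF

size-left-right : ∀ s → size (left s) + size (right s) ≤ suc (size s)
size-left-right nil     = ≤-refl
size-left-right (a ∙ b) = ≤-trans (n≤1+n _) (n≤1+n _)

-- The consumed list cell pays for the written one. This sharp balance is for `binF`, where the
-- numeral is itself the loop state: an increment may enlarge it only by an amount independent of
-- its size, which `carryF-grow` does not give.
carry-shrinks : ∀ e c o b l → size (⟦ carryF ⟧ (e ∙ (c ∙ o) ∙ (b ∙ l))) + size l ≤ size (c ∙ o) + size (b ∙ l)
carry-shrinks e nil o b l = ≤-reflexive (rearrange (size b) (size o) (size l))
  where
  rearrange : ∀ b o l → suc (1 + suc (b + o)) + l ≡ suc (1 + o) + suc (b + l)
  rearrange = solve-∀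
carry-shrinks e (c ∙ c′) o nil l = begin
  suc (1 + suc (3 + size o)) + size l                 ≤⟨ +-monoˡ-≤ (size l) (+-monoʳ-≤ 2 (s≤s (+-monoˡ-≤ (size o) (s≤s (+-mono-≤ (1≤size c) (1≤size c′)))))) ⟩
  suc (1 + suc (suc (size c + size c′) + size o)) + size l ≡⟨ rearrange (size c) (size c′) (size o) (size l) ⟩
  suc (suc (size c + size c′) + size o) + (1 + suc (size l)) ∎
  where
  open ≤-Reasoning
  rearrange : ∀ c c′ o l → suc (1 + suc (suc (c + c′) + o)) + l ≡ suc (suc (c + c′) + o) + (1 + suc l)
  rearrange = solve-∀
carry-shrinks e (c ∙ c′) o (b ∙ b′) l = begin
  suc (C + suc (1 + size o)) + size l        ≡⟨ rearrange C (size o) (size l) ⟩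
  suc (C + size o) + suc (1 + size l)        ≤⟨ +-monoʳ-≤ (suc (C + size o)) (s≤s (+-monoˡ-≤ (size l) (1≤size (b ∙ b′)))) ⟩
  suc (C + size o) + suc (size (b ∙ b′) + size l) ∎
  where
  open ≤-Reasoning
  C : ℕ
  C = size (c ∙ c′)
  rearrange : ∀ c o l → suc (c + suc (1 + o)) + l ≡ suc (c + o) + suc (1 + l)
  rearrange = solve-∀

carry-pair : ∀ e s l → ∃[ c ] ∃[ o ] ⟦ carryF ⟧ (e ∙ s ∙ l) ≡ c ∙ o
carry-pair e s l with left s | left l
... | nil   | _     = _ , _ , refl
... | _ ∙ _ | nil   = _ , _ , refl
... | _ ∙ _ | _ ∙ _ = _ , _ , refl

carryF-grow : ∀ e s l → size (⟦ carryF ⟧ (e ∙ s ∙ l)) ≤ size s + (6 + size (e ∙ l))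
carryF-grow e s l with left s | left l | size-left-right s | size-left l
... | nil | b | _ | b≤ = begin
  3 + (size b + size (right s))          ≤⟨ +-monoʳ-≤ 3 (+-mono-≤ b≤ (size-right s)) ⟩
  3 + (size l + size s)                  ≡⟨ +-comm 3 (size l + size s) ⟩
  size l + size s + 3                    ≤⟨ +-mono-≤ (+-monoˡ-≤ (size s) (m≤n+m (size l) (size e))) (m≤m+n 3 4) ⟩
  size e + size l + size s + 7           ≡⟨ rearrange (size e) (size l) (size s) ⟩
  size s + (6 + suc (size e + size l))   ∎
  where
  open ≤-Reasoning
  rearrange : ∀ e l s → e + l + s + 7 ≡ s + (6 + suc (e + l))
  rearrange = solve-∀
... | _ ∙ _ | nil | _ | _ = begin
  6 + size (right s)                     ≡⟨ +-comm 6 (size (right s)) ⟩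
  size (right s) + 6                     ≤⟨ +-mono-≤ (size-right s) (m≤m+n 6 _) ⟩
  size s + (6 + size (e ∙ l))            ∎
  where open ≤-Reasoning
... | c ∙ c′ | _ ∙ _ | co≤ | _ = begin
  1 + (C + (2 + size (right s)))         ≡⟨ rearrange C (size (right s)) ⟩
  (C + size (right s)) + 3               ≤⟨ +-monoˡ-≤ 3 co≤ ⟩
  suc (size s) + 3                       ≡⟨ +-suc (size s) 3 ⟨
  size s + 4                             ≤⟨ +-monoʳ-≤ (size s) (m≤m+n 4 _) ⟩
  size s + (6 + size (e ∙ l))            ∎
  where
  open ≤-Reasoning
  C : ℕ
  C = size (c ∙ c′)
  rearrange : ∀ c o → 1 + (c + (2 + o)) ≡ (c + o) + 3
  rearrange = solve-∀

carriesF : Fun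
carriesF = iterF carryF (K 6 ⊕ X) carryF-grow (pairF (pairF nilF nilF) nilF) idF

-- A carry that survives becomes the top bit; it goes in front because the output is still reversed.
finishF : Fun
finishF = ifF leftF (pairF (pairF nilF nilF) rightF) rightF

abstract
  incF : Fun
  incF = reverseF (finishF ∘F carriesF)

  size-carries : ∀ e c o l → size (iter ⟦ carryF ⟧ e (c ∙ o) l) + 1 ≤ size (c ∙ o) + size l
  size-carries e c o nil     = ≤-refl
  size-carries e c o (b ∙ l) with ⟦ carryF ⟧ (e ∙ (c ∙ o) ∙ (b ∙ l)) | carry-pair e (c ∙ o) (b ∙ l) | carry-shrinks e c o b l
  ... | _ | c′ , o′ , refl | shrinks = ≤-trans (size-carries e c′ o′ l) shrinks

  size-finish : ∀ s → size (⟦ finishF ⟧ s) ≤ size s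
  size-finish nil             = ≤-refl
  size-finish (nil ∙ o)       = m≤n+m (size o) 2
  size-finish ((c ∙ c′) ∙ o)  = s≤s (+-monoˡ-≤ (size o) (s≤s (+-mono-≤ (1≤size c) (1≤size c′))))

  size-inc : ∀ x → size (⟦ incF ⟧ x) ≤ size x + 5
  size-inc x = begin
    size (⟦ incF ⟧ x)                           ≤⟨ size-iter-push x nil _ ⟩
    1 + size (⟦ finishF ⟧ (⟦ carriesF ⟧ x))     ≤⟨ s≤s (size-finish _) ⟩
    1 + size (⟦ carriesF ⟧ x)                   ≡⟨ +-comm 1 _ ⟩
    -- The initial state, carry `true` and no output, has size 5.
    size (⟦ carriesF ⟧ x) + 1                   ≤⟨ size-carries x (nil ∙ nil) nil x ⟩
    5 + size x                                  ≡⟨ +-comm 5 (size x) ⟩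
    size x + 5                                  ∎
    where open ≤-Reasoning

  incF-correct : ∀ l → ⟦ incF ⟧ (encodeBits l) ≡ encodeBits (inc l)
  incF-correct l = trans (reverseF-correct (finishF ∘F carriesF) {encodeBits l} (reverse (map encodeBool (inc l))) (go true [] l))
    (cong encodeList (List.reverse-involutive (map encodeBool (inc l))))
    where
    x : Tree
    x = encodeBits l
    carried : Bool → List Bool → List Bool
    carried true  l = inc l
    carried false l = l
    go : ∀ c o l → ⟦ finishF ⟧ (iter ⟦ carryF ⟧ x (encodeBool c ∙ encodeBits o) (encodeBits l))
         ≡ encodeList (map encodeBool (carried c l) ʳ++ map encodeBool o)
    go false o []          = refl
    go true  o []          = refl
    go false o (b ∷ l)     = go false (b ∷ o) l
    go true  o (false ∷ l) = go false (true ∷ o) l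
    go true  o (true ∷ l)  = go true (false ∷ o) l

  binF : Fun → Fun
  binF k = iterF (incF ∘F stateF) (K 5) (λ e s l → size-inc s) nilF k

  binF-correct : ∀ f {e} k → ⟦ f ⟧ e ≡ unary k → ⟦ binF f ⟧ e ≡ encodeBits (bin k)
  binF-correct f {e} k eq rewrite eq = trans (go k 0) (cong (encodeBits ∘ bin) (+-identityʳ k))
    where
    go : ∀ k j → iter ⟦ incF ∘F stateF ⟧ e (encodeBits (bin j)) (unary k) ≡ encodeBits (bin (k + j))
    go zero    j = refl
    go (suc k) j = trans (cong (λ s → iter ⟦ incF ∘F stateF ⟧ e s (unary k)) (incF-correct (bin j)))
      (trans (go k (suc j)) (cong (encodeBits ∘ bin) (+-suc k j)))

-- Circuits in layers

mapGate : ∀ {w w′} → (Fin w → Fin w′) → Gate w → Gate w′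
mapGate ρ (AND is)    = AND (map ρ is)
mapGate ρ (OR is)     = OR (map ρ is)
mapGate ρ (PARITY is) = PARITY (map ρ is)
mapGate ρ (NOT i)     = NOT (ρ i)

map-map-cong : ∀ {a} {A B C : Set a} {f : B → C} {g : A → B} {h : A → C} →
               (∀ x → f (g x) ≡ h x) → ∀ xs → map f (map g xs) ≡ map h xs
map-map-cong eq xs = trans (sym (List.map-∘ xs)) (List.map-cong eq xs)

evalGate-mapGate : ∀ {w w′} (ρ : Fin w → Fin w′) (v : Bits w) (v′ : Bits w′) →
                   (∀ i → lookup v′ (ρ i) ≡ lookup v i) → ∀ g → evalGate (mapGate ρ g) v′ ≡ evalGate g v
evalGate-mapGate ρ v v′ eq (AND is)    = cong and (map-map-cong eq is)
evalGate-mapGate ρ v v′ eq (OR is)     = cong or (map-map-cong eq is)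
evalGate-mapGate ρ v v′ eq (PARITY is) = cong (foldr _xor_ false) (map-map-cong eq is)
evalGate-mapGate ρ v v′ eq (NOT i)     = cong not (eq i)

encodeGate-mapGate : ∀ {w w′} (ρ : Fin w → Fin w′) → (∀ i → toℕ (ρ i) ≡ toℕ i) →
                     ∀ g → encodeGate (mapGate ρ g) ≡ encodeGate g
encodeGate-mapGate ρ eq (AND is)    = cong (λ l → unary 0 ∙ encodeList l) (map-map-cong (cong unary ∘ eq) is)
encodeGate-mapGate ρ eq (OR is)     = cong (λ l → unary 1 ∙ encodeList l) (map-map-cong (cong unary ∘ eq) is)
encodeGate-mapGate ρ eq (PARITY is) = cong (λ l → unary 2 ∙ encodeList l) (map-map-cong (cong unary ∘ eq) is)
encodeGate-mapGate ρ eq (NOT i)     = cong (λ k → unary 3 ∙ unary k) (eq i)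

old : ∀ {w} k → Fin w → Fin (k + w)
old zero    i = i
old (suc k) i = inject₁ (old k i)

-- The new wires carry the highest indices, from `w` on, while each gate puts its `suc` in front of
-- the wire count; the cast reconciles `w + k` with `k + w`.
new : ∀ {w} k → Fin k → Fin (k + w)
new {w} k j = cast (+-comm w k) (w ↑ʳ j)

toℕ-old : ∀ {w} k (i : Fin w) → toℕ (old k i) ≡ toℕ i
toℕ-old zero    i = refl
toℕ-old (suc k) i = trans (toℕ-inject₁ (old k i)) (toℕ-old k i)

toℕ-new : ∀ {w} k (j : Fin k) → toℕ (new {w} k j) ≡ w + toℕ j
toℕ-new {w} k j = trans (toℕ-cast (+-comm w k) (w ↑ʳ j)) (toℕ-↑ʳ w j)

new-fromℕ : ∀ {w} k → new {w} (suc k) (fromℕ k) ≡ fromℕ (k + w)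
new-fromℕ {w} k = toℕ-injective (begin
  toℕ (new {w} (suc k) (fromℕ k))   ≡⟨ toℕ-new (suc k) (fromℕ k) ⟩
  w + toℕ (fromℕ k)                 ≡⟨ cong (w +_) (toℕ-fromℕ k) ⟩
  w + k                             ≡⟨ +-comm w k ⟩
  k + w                             ≡⟨ toℕ-fromℕ (k + w) ⟨
  toℕ (fromℕ (k + w))               ∎)
  where open ≡-Reasoning

new-inject₁ : ∀ {w} k (j : Fin k) → new {w} (suc k) (inject₁ j) ≡ inject₁ (new k j)
new-inject₁ {w} k j = toℕ-injective (begin
  toℕ (new {w} (suc k) (inject₁ j))   ≡⟨ toℕ-new (suc k) (inject₁ j) ⟩
  w + toℕ (inject₁ j)                 ≡⟨ cong (w +_) (toℕ-inject₁ j) ⟩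
  w + toℕ j                           ≡⟨ toℕ-new k j ⟨
  toℕ (new {w} k j)                   ≡⟨ toℕ-inject₁ (new k j) ⟨
  toℕ (inject₁ (new {w} k j))         ∎)
  where open ≡-Reasoning

-- All gates of a layer read wires below it, so each is evaluated on the same values, whatever its
-- place in the layer.
layer : ∀ {M w} → Gates M w → ∀ k → (Fin k → Gate w) → Gates M (k + w)
layer c zero    g = c
layer c (suc k) g = layer c k (g ∘ inject₁) ▷ mapGate (old k) (g (fromℕ k))

lookup-∷ʳ-inject₁ : ∀ {a} {A : Set a} {n} (v : Vec A n) x i → lookup (v Vec.∷ʳ x) (inject₁ i) ≡ lookup v i
lookup-∷ʳ-inject₁ (y ∷ v) x zero    = refl
lookup-∷ʳ-inject₁ (y ∷ v) x (suc i) = lookup-∷ʳ-inject₁ v x i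

lookup-∷ʳ-fromℕ : ∀ {a} {A : Set a} {n} (v : Vec A n) x → lookup (v Vec.∷ʳ x) (fromℕ n) ≡ x
lookup-∷ʳ-fromℕ []      x = refl
lookup-∷ʳ-fromℕ (y ∷ v) x = lookup-∷ʳ-fromℕ v x

layer-old : ∀ {M w} (c : Gates M w) k g x i →
            lookup (evalGates (layer c k g) x) (old k i) ≡ lookup (evalGates c x) i
layer-old c zero    g x i = refl
layer-old c (suc k) g x i = trans (lookup-∷ʳ-inject₁ (evalGates (layer c k (g ∘ inject₁)) x) _ (old k i)) (layer-old c k (g ∘ inject₁) x i)

layer-new : ∀ {M w} (c : Gates M w) k g x j →
            lookup (evalGates (layer c k g) x) (new k j) ≡ evalGate (g j) (evalGates c x)
layer-new {w = w} c (suc k) g x j with view j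
... | ‵fromℕ     = trans (cong (lookup (v Vec.∷ʳ evalGate g′ v)) (new-fromℕ k))
  (trans (lookup-∷ʳ-fromℕ v (evalGate g′ v)) (evalGate-mapGate (old k) (evalGates c x) v (layer-old c k (g ∘ inject₁) x) (g (fromℕ k))))
  where
  v  = evalGates (layer c k (g ∘ inject₁)) x
  g′ = mapGate (old k) (g (fromℕ k))
... | ‵inject₁ j = trans (cong (lookup (v Vec.∷ʳ b)) (new-inject₁ k j))
  (trans (lookup-∷ʳ-inject₁ v b (new k j)) (layer-new c k (g ∘ inject₁) x j))
  where
  v = evalGates (layer c k (g ∘ inject₁)) x
  b = evalGate (mapGate (old k) (g (fromℕ k))) v

-- In order of creation, so that a layer contributes a suffix and programs can emit layers by
-- `appendF`; one final reversal gives `encodeGates`.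
gateList : ∀ {M w} → Gates M w → List Tree
gateList inputs  = []
gateList (c ▷ g) = gateList c ∷ʳ encodeGate g

encodeGates-gateList : ∀ {M w} (c : Gates M w) → encodeGates c ≡ encodeList (reverse (gateList c))
encodeGates-gateList inputs  = refl
encodeGates-gateList (c ▷ g) = trans (cong (encodeGate g ∙_) (encodeGates-gateList c))
  (cong encodeList (sym (List.reverse-++ (gateList c) (encodeGate g ∷ []))))

gateList-layer : ∀ {M w} (c : Gates M w) k g → gateList (layer c k g) ≡ gateList c ++ tabulate (encodeGate ∘ g)
gateList-layer c zero    g = sym (List.++-identityʳ (gateList c))
gateList-layer c (suc k) g = begin
  gateList (layer c k (g ∘ inject₁)) ∷ʳ encodeGate (mapGate (old k) (g (fromℕ k)))
    ≡⟨ cong₂ _∷ʳ_ (gateList-layer c k (g ∘ inject₁)) (encodeGate-mapGate (old k) (toℕ-old k) (g (fromℕ k))) ⟩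
  (gateList c ++ tabulate (encodeGate ∘ g ∘ inject₁)) ∷ʳ encodeGate (g (fromℕ k))
    ≡⟨ List.++-assoc (gateList c) _ _ ⟩
  gateList c ++ (tabulate (encodeGate ∘ g ∘ inject₁) ∷ʳ encodeGate (g (fromℕ k)))
    ≡⟨ cong (gateList c ++_) (tabulate-∷ʳ (encodeGate ∘ g)) ⟨
  gateList c ++ tabulate (encodeGate ∘ g) ∎
  where open ≡-Reasoning

-- Fan-in lists, the tester and the generator

pick : ∀ {a} {A : Set a} {k} → (Fin k → Bool) → (Fin k → A) → List A
pick c h = concat (tabulate λ i → if c i then h i ∷ [] else [])

map-pick : ∀ {a} {A B : Set a} (f : A → B) {k} c (h : Fin k → A) → map f (pick c h) ≡ pick c (f ∘ h)
map-pick f {zero}  c h = refl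
map-pick f {suc k} c h with c zero
... | true  = cong (f (h zero) ∷_) (map-pick f (c ∘ suc) (h ∘ suc))
... | false = map-pick f (c ∘ suc) (h ∘ suc)

pick-cong : ∀ {a} {A : Set a} {k} c {h h′ : Fin k → A} → (∀ i → c i ≡ true → h i ≡ h′ i) → pick c h ≡ pick c h′
pick-cong {k = zero}  c eq = refl
pick-cong {k = suc k} c eq with c zero | eq zero
... | true  | eq₀ = cong₂ _∷_ (eq₀ refl) (pick-cong (c ∘ suc) (eq ∘ suc))
... | false | _   = pick-cong (c ∘ suc) (eq ∘ suc)

toList-blocks : ∀ {a} {A : Set a} n {l} (f : Fin n → Fin l → A) →
  Vec.toList (Vec.concat (Vec.tabulate λ s → Vec.tabulate (f s))) ≡ concat (tabulate λ s → tabulate (f s))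
toList-blocks zero    f = refl
toList-blocks (suc n) f = trans (Vec.toList-++ (Vec.tabulate (f zero)) _)
  (cong₂ _++_ (toList-tabulate (f zero)) (toList-blocks n (f ∘ suc)))
  where
  toList-tabulate : ∀ {k} g → Vec.toList (Vec.tabulate {n = k} g) ≡ tabulate g
  toList-tabulate {zero}  g = refl
  toList-tabulate {suc k} g = cong (g zero ∷_) (toList-tabulate (g ∘ suc))

parity : ∀ {k} → (Fin k → Bool) → Bool
parity g = foldr _xor_ false (tabulate g)

map-tabulate-cong : ∀ {a} {A B : Set a} {k} (f : A → B) (g : Fin k → A) {h : Fin k → B} →
                    (∀ i → f (g i) ≡ h i) → map f (tabulate g) ≡ tabulate h
map-tabulate-cong f g eq = trans (List.map-tabulate g f) (List.tabulate-cong eq)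

bit : ∀ n {l} → Bits (n * l) → Fin n → Fin l → Bool
bit n x s j = lookup x (combine s j)

module _ (n l : ℕ) where
  testerGates : Gates (n * l) (1 + (1 + (n + n * l)))
  testerGates = layer (layer (layer inputs n (λ s → PARITY (tabulate (combine s))))
                             1 (λ _ → OR (tabulate (new n))))
                      1 (λ _ → NOT (new 1 zero))

  tester : Circuit (n * l) 1
  tester = circuit testerGates (new 1 zero ∷ [])

  eval-tester : ∀ x → eval₁ tester x ≡ not (or (tabulate λ s → parity (bit n x s)))
  eval-tester x = begin
    lookup (evalGates testerGates x) (new 1 zero)   ≡⟨ layer-new c₂ 1 (λ _ → NOT (new 1 zero)) x zero ⟩
    not (lookup (evalGates c₂ x) (new 1 zero))      ≡⟨ cong not (layer-new c₁ 1 (λ _ → OR (tabulate (new n))) x zero) ⟩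
    not (or (map (lookup (evalGates c₁ x)) (tabulate (new n))))
      ≡⟨ cong (not ∘ or) (map-tabulate-cong _ (new n) λ s →
           trans (layer-new inputs n _ x s) (cong (foldr _xor_ false) (List.map-tabulate (combine s) (lookup x)))) ⟩
    not (or (tabulate λ s → parity (bit n x s)))      ∎
    where
    open ≡-Reasoning
    c₁ : Gates (n * l) (n + n * l)
    c₁ = layer inputs n (λ s → PARITY (tabulate (combine s)))
    c₂ : Gates (n * l) (1 + (n + n * l))
    c₂ = layer c₁ 1 (λ _ → OR (tabulate (new n)))

-- Patterns and relevant selectors stay parameters, so that correctness can be shown for every
-- separating choice. The first layer negates the selectors because a pattern tests them in both
-- polarities.
module Generator (n m l : ℕ) (adj pat : Fin n → Fin m → Bool) (care : Fin n → Bool) where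
  M : ℕ
  M = n * suc l

  matchGate : Fin m → Gate (n + M)
  matchGate u = AND (pick care λ s → if pat s u then old n (combine s zero) else new n s)

  shiftGate : Fin n → Gate (m + (n + M))
  shiftGate s = OR (pick (adj s) (new m))

  outGate : Fin n → Gate (n + (m + (n + M)))
  outGate s = PARITY (new n s ∷ tabulate λ j → old n (old m (old n (combine s (suc j)))))

  notGates : Gates M (n + M)
  notGates = layer inputs n λ s → NOT (combine s zero)

  matchGates : Gates M (m + (n + M))
  matchGates = layer notGates m matchGate

  shiftGates : Gates M (n + (m + (n + M)))
  shiftGates = layer matchGates n shiftGate

  outGates : Gates M (n + (n + (m + (n + M))))
  outGates = layer shiftGates n outGate

  out : Fin n → Fin (suc l) → Fin (n + (n + (m + (n + M))))
  out s zero    = new n s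
  out s (suc j) = old n (old n (old m (old n (combine s (suc j)))))

  generator : Circuit M M
  generator = circuit outGates (Vec.concat (Vec.tabulate λ s → Vec.tabulate (out s)))

  match : Bits M → Fin m → Bool
  match r u = and (pick care λ s → if pat s u then bit n r s zero else not (bit n r s zero))

  -- Several elements may match at once when their patterns coincide. Under the later separation
  -- hypothesis they have equal neighbourhoods, so the disjunction is the neighbourhood of any one
  -- of them.
  shift : Bits M → Fin n → Bool
  shift r s = or (pick (adj s) (match r))

  eval-generator : ∀ r s j → bit n (eval generator r) s j ≡ lookup (evalGates outGates r) (out s j)
  eval-generator r s j = begin
    lookup (Vec.map (lookup w) (Vec.concat outs)) (combine s j)   ≡⟨ Vec.lookup-map (combine s j) (lookup w) (Vec.concat outs) ⟩
    lookup w (lookup (Vec.concat outs) (combine s j))             ≡⟨ cong (lookup w) (Vec.lookup-concat outs s j) ⟩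
    lookup w (lookup (lookup outs s) j)                           ≡⟨ cong (λ v → lookup w (lookup v j)) (Vec.lookup∘tabulate (λ s → Vec.tabulate (out s)) s) ⟩
    lookup w (lookup (Vec.tabulate (out s)) j)                    ≡⟨ cong (lookup w) (Vec.lookup∘tabulate (out s) j) ⟩
    lookup w (out s j)                                            ∎
    where
    open ≡-Reasoning
    w = evalGates outGates r
    outs = Vec.tabulate λ s → Vec.tabulate (out s)

  shiftGates-input : ∀ r i → lookup (evalGates shiftGates r) (old n (old m (old n i))) ≡ lookup r i
  shiftGates-input r i = trans (layer-old matchGates n shiftGate r _)
    (trans (layer-old notGates m matchGate r _) (layer-old inputs n _ r i))

  generator-free : ∀ r s j → bit n (eval generator r) s (suc j) ≡ bit n r s (suc j)
  generator-free r s j = trans (eval-generator r s (suc j))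
    (trans (layer-old shiftGates n outGate r _) (shiftGates-input r (combine s (suc j))))

  matchGates-match : ∀ r u → lookup (evalGates matchGates r) (new m u) ≡ match r u
  matchGates-match r u = trans (layer-new notGates m matchGate r u)
    (cong and (trans (map-pick (lookup (evalGates notGates r)) care (λ s → if pat s u then old n (combine s zero) else new n s))
                     (pick-cong care λ s _ → literal s)))
    where
    literal : ∀ s → lookup (evalGates notGates r) (if pat s u then old n (combine s zero) else new n s)
              ≡ (if pat s u then bit n r s zero else not (bit n r s zero))
    literal s with pat s u
    ... | true  = layer-old inputs n _ r (combine s zero)
    ... | false = layer-new inputs n _ r s

  shiftGates-shift : ∀ r s → lookup (evalGates shiftGates r) (new n s) ≡ shift r s
  shiftGates-shift r s = trans (layer-new matchGates n shiftGate r s)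
    (cong or (trans (map-pick (lookup (evalGates matchGates r)) (adj s) (new m)) (pick-cong (adj s) λ u _ → matchGates-match r u)))

  generator-parity : ∀ r s → bit n (eval generator r) s zero ≡ shift r s xor parity (λ j → bit n r s (suc j))
  generator-parity r s = trans (eval-generator r s zero) (trans (layer-new shiftGates n outGate r s)
    (cong₂ _xor_ (shiftGates-shift r s) (cong (foldr _xor_ false)
      (map-tabulate-cong (lookup (evalGates shiftGates r)) (λ j → old n (old m (old n (combine s (suc j)))))
        (λ j → shiftGates-input r (combine s (suc j)))))))

-- The program of the reduction

truth : Tree → Bool
truth nil     = false
truth (_ ∙ _) = true

branch-truth : ∀ t y z → branch t y z ≡ (if truth t then y else z)
branch-truth nil     y z = refl
branch-truth (_ ∙ _) y z = refl

ifF-correct : ∀ c f g {e} b {y z} → truth (⟦ c ⟧ e) ≡ b → ⟦ f ⟧ e ≡ y → ⟦ g ⟧ e ≡ z →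
              ⟦ ifF c f g ⟧ e ≡ (if b then y else z)
ifF-correct c f g {e} b refl refl refl = branch-truth (⟦ c ⟧ e) _ _

pickF : Fun → Fun → Fun → Fun
pickF c b k = concatF (tabulateF (ifF c (pairF b nilF) nilF) k)

pickF-correct : ∀ c b f {e k} (C : Fin k → Bool) (h : Fin k → Tree) → ⟦ f ⟧ e ≡ unary k →
  (∀ i → truth (⟦ c ⟧ (unary (toℕ i) ∙ e)) ≡ C i) → (∀ i → ⟦ b ⟧ (unary (toℕ i) ∙ e) ≡ h i) →
  ⟦ pickF c b f ⟧ e ≡ encodeList (pick C h)
pickF-correct c b f {e} C h eqk eqc eqb =
  concatF-correct (tabulateF (ifF c (pairF b nilF) nilF) f) (tabulate cell)
    (trans (tabulateF-correct (ifF c (pairF b nilF) nilF) f (encodeList ∘ cell) eqk λ i →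
              trans (ifF-correct c (pairF b nilF) nilF {unary (toℕ i) ∙ e} (C i) (eqc i) (cong (_∙ nil) (eqb i)) refl) (push-if (C i)))
           (cong encodeList (sym (List.map-tabulate cell encodeList))))
  where
  cell : _ → List Tree
  cell i = if C i then h i ∷ [] else []
  push-if : ∀ {x} b → (if b then x ∙ nil else nil) ≡ encodeList (if b then x ∷ [] else [])
  push-if true  = refl
  push-if false = refl

constF : ℕ → Fun
constF zero    = nilF
constF (suc k) = sucF (constF k)

bitAt : List Bool → ℕ → Bool
bitAt []      k       = false
bitAt (b ∷ l) zero    = b
bitAt (b ∷ l) (suc k) = bitAt l k

drop-nil : ∀ k → drop k nil ≡ nil
drop-nil zero    = refl
drop-nil (suc k) = drop-nil k

truth-encodeBool : ∀ b → truth (encodeBool b) ≡ b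
truth-encodeBool true  = refl
truth-encodeBool false = refl

-- A nonempty remainder serves as the comparison `k < length l`; this is how programs test `care`
-- and the case distinction in `pat`.
truth-drop : ∀ l k → truth (drop k (encodeBits l)) ≡ (k <ᵇ length l)
truth-drop []      k       = cong truth (drop-nil k)
truth-drop (b ∷ l) zero    = refl
truth-drop (b ∷ l) (suc k) = truth-drop l k

truth-left-drop : ∀ l k → truth (left (drop k (encodeBits l))) ≡ bitAt l k
truth-left-drop []      k       = cong (truth ∘ left) (drop-nil k)
truth-left-drop (b ∷ l) zero    = truth-encodeBool b
truth-left-drop (b ∷ l) (suc k) = truth-left-drop l k

-- Variables are de Bruijn indices into a tree of bindings.
infix 20 #_ ↑_

↑_ : Fun → Fun
↑ f = f ∘F rightF

#_ : ℕ → Fun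
# zero  = leftF
# suc k = ↑ (# k)

-- `lV` is the block length `suc l`, so its tail counts the free positions. `binV` is the last
-- component of the bindings and hence a bare tail.
nV mV rowsV lV MV binV : Fun
nV    = # 0
mV    = # 1
rowsV = # 2
lV    = # 3
MV    = # 4
binV  = rightF ∘F rightF ∘F rightF ∘F rightF ∘F rightF

-- The leading constants are the tags of `encodeGate`. Adding `nilF`, the number 0, keeps the first
-- wire of a layer or block in the form shared by all its wires.
parityGateF testerF : Fun
parityGateF = pairF (constF 2) (tabulateF (addF (mulF (↑ ↑ lV) (# 1)) (# 0)) (↑ lV))
testerF = pairF
  (reverseF (appendF (appendF (tabulateF parityGateF nV)
                              (pairF (pairF (constF 1) (tabulateF (addF (↑ MV) (# 0)) nV)) nilF))
                     (pairF (pairF (constF 3) (addF (addF nV MV) nilF)) nilF)))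
  (pairF (addF (sucF (addF nV MV)) nilF) nilF)

blockStartF adjF patF notGateF matchGateF shiftGateF outGateF outWireF generatorF : Fun
-- In scope: set.
blockStartF = addF (mulF (↑ lV) (# 0)) nilF
-- In scope: set, element.
adjF = atF (# 0) (atF (# 1) (↑ ↑ rowsV))
patF = ifF (dropF (↑ ↑ nV) (↑ ↑ binV)) adjF (atF (# 0) (binF (sucF (# 1))))
notGateF = pairF (constF 3) blockStartF
-- In scope: element.
matchGateF = pairF (constF 0)
  (pickF (dropF (# 0) (↑ ↑ binV))
         (ifF patF (addF (mulF (↑ ↑ lV) (# 0)) nilF) (addF (↑ ↑ MV) (# 0))) (↑ nV))
-- In scope: set.
shiftGateF = pairF (constF 1)
  (pickF (atF (# 1) (atF (# 0) (↑ ↑ rowsV))) (addF (addF (↑ ↑ nV) (↑ ↑ MV)) (# 0)) (↑ mV))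
outGateF = pairF (constF 2)
  (pairF (addF (addF (↑ mV) (addF (↑ nV) (↑ MV))) (# 0))
         (tabulateF (addF (mulF (↑ ↑ lV) (# 1)) (sucF (# 0))) (rightF ∘F (↑ lV))))
-- In scope: position, set.
outWireF = ifF (# 0) (addF (mulF (↑ ↑ lV) (# 1)) (# 0))
  (addF (addF (↑ ↑ nV) (addF (↑ ↑ mV) (addF (↑ ↑ nV) (↑ ↑ MV)))) (# 1))
generatorF = pairF
  (reverseF (appendF (appendF (appendF (tabulateF notGateF nV) (tabulateF matchGateF mV))
                              (tabulateF shiftGateF nV))
                     (tabulateF outGateF nV)))
  (concatF (tabulateF (tabulateF outWireF (↑ lV)) nV))

bindingsF reductionF : Fun
bindingsF = pairF n (pairF m (pairF (rightF ∘F rightF ∘F leftF) (pairF rightF (pairF (mulF n rightF) (binF m)))))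
  where
  n m : Fun
  n = leftF ∘F leftF
  m = leftF ∘F rightF ∘F leftF
reductionF = pairF testerF generatorF ∘F bindingsF

module Code (S : Instance) (l : ℕ) where
  n m : ℕ
  n = #sets S
  m = #elems S

  care : Fin n → Bool
  care s = toℕ s <ᵇ length (bin m)

  -- Only the first length (bin m) ≈ log₂ m selectors matter.  They encode u as
  -- the binary number u + 1 or, if there are fewer than length (bin m) sets, and
  -- hence 2 ^ n is at most 2 * m, as the neighbourhood of u.
  pat : Fin n → Fin m → Bool
  pat s u = if n <ᵇ length (bin m) then adj S s u else bitAt (bin (suc (toℕ u))) (toℕ s)

  open Generator n m l (adj S) pat care public

  row : Fin m → Tree
  row u = encodeList (tabulate λ s → encodeBool (adj S s u))

  E : Tree
  E = unary n ∙ unary m ∙ encodeList (tabulate row) ∙ unary (suc l) ∙ unary M ∙ encodeBits (bin m)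

  wire-correct : ∀ f g h {e} i {k} → ⟦ f ⟧ e ≡ unary (suc l) → ⟦ g ⟧ e ≡ unary (toℕ i) → ⟦ h ⟧ e ≡ unary (toℕ k) →
                 ⟦ addF (mulF f g) h ⟧ e ≡ encodeWire (combine {n} {suc l} i k)
  wire-correct f g h i {k} p q r = trans (addF-correct (mulF f g) h (suc l * toℕ i) (toℕ k) (mulF-correct f g (suc l) (toℕ i) p q) r)
    (cong unary (sym (toℕ-combine i k)))

  wires-correct : ∀ f {e} {w : ℕ} k (g : Fin k → Fin w) → ⟦ f ⟧ e ≡ encodeList (tabulate (encodeWire ∘ g)) →
                  ⟦ f ⟧ e ≡ encodeList (map encodeWire (tabulate g))
  wires-correct f k g eq = trans eq (cong encodeList (sym (List.map-tabulate g encodeWire)))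

  new-correct : ∀ f g {e} {w} k (j : Fin k) → ⟦ f ⟧ e ≡ unary w → ⟦ g ⟧ e ≡ unary (toℕ j) →
                ⟦ addF f g ⟧ e ≡ encodeWire (new {w} k j)
  new-correct f g {w = w} k j p q = trans (addF-correct f g w (toℕ j) p q) (cong unary (sym (toℕ-new k j)))

  parityGate-correct : ∀ s → ⟦ parityGateF ⟧ (unary (toℕ s) ∙ E) ≡ encodeGate (PARITY (tabulate (combine {n} {suc l} s)))
  parityGate-correct s = cong (unary 2 ∙_) (wires-correct wiresF (suc l) (combine s)
    (tabulateF-correct (addF (mulF (↑ ↑ lV) (# 1)) (# 0)) (↑ lV) (encodeWire ∘ combine s) refl
      λ j → wire-correct (↑ ↑ lV) (# 1) (# 0) {unary (toℕ j) ∙ unary (toℕ s) ∙ E} s {j} refl refl refl))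
    where
    wiresF : Fun
    wiresF = tabulateF (addF (mulF (↑ ↑ lV) (# 1)) (# 0)) (↑ lV)

  M-wire : ∀ f g {e} → ⟦ f ⟧ e ≡ unary n → ⟦ g ⟧ e ≡ unary M → ⟦ addF f g ⟧ e ≡ unary (n + M)
  M-wire f g p q = addF-correct f g n M p q

  first-layer : ∀ f {e} k h → ⟦ f ⟧ e ≡ encodeList (tabulate (encodeGate ∘ h)) →
                ⟦ f ⟧ e ≡ encodeList (gateList (layer (inputs {M}) k h))
  first-layer f k h eq = trans eq (cong encodeList (sym (gateList-layer inputs k h)))

  next-layer : ∀ f g {e w} (c : Gates M w) k h → ⟦ f ⟧ e ≡ encodeList (gateList c) →
               ⟦ g ⟧ e ≡ encodeList (tabulate (encodeGate ∘ h)) → ⟦ appendF f g ⟧ e ≡ encodeList (gateList (layer c k h))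
  next-layer f g c k h p q = trans (appendF-correct f g (gateList c) (tabulate (encodeGate ∘ h)) p q)
    (cong encodeList (sym (gateList-layer c k h)))

  gates-correct : ∀ f {e w} (c : Gates M w) → ⟦ f ⟧ e ≡ encodeList (gateList c) → ⟦ reverseF f ⟧ e ≡ encodeGates c
  gates-correct f c eq = trans (reverseF-correct f (gateList c) eq) (sym (encodeGates-gateList c))

  tester-correct : ⟦ testerF ⟧ E ≡ encodeCircuit (tester n (suc l))
  tester-correct = cong₂ _∙_
    (gates-correct gates₃ (testerGates n (suc l))
      (next-layer gates₂ notF c₂ 1 (λ _ → NOT (new 1 zero))
        (next-layer gates₁ orF c₁ 1 (λ _ → OR (tabulate (new n)))
          (first-layer gates₁ n parityGate
            (tabulateF-correct parityGateF nV (encodeGate ∘ parityGate) refl parityGate-correct))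
          (cong (λ t → (unary 1 ∙ t) ∙ nil) (wires-correct (tabulateF (addF (↑ MV) (# 0)) nV) n (new {M} n)
            (tabulateF-correct (addF (↑ MV) (# 0)) nV (encodeWire ∘ new {M} n) refl
              λ i → new-correct (↑ MV) (# 0) {unary (toℕ i) ∙ E} n i refl refl))))
        (cong (λ t → (unary 3 ∙ t) ∙ nil) (new-correct (addF nV MV) nilF {E} 1 zero (M-wire nV MV {E} refl refl) refl))))
    (cong (_∙ nil) (new-correct (sucF (addF nV MV)) nilF {E} 1 zero (cong (nil ∙_) (M-wire nV MV {E} refl refl)) refl))
    where
    gates₁ orF notF gates₂ gates₃ : Fun
    gates₁ = tabulateF parityGateF nV
    orF    = pairF (pairF (constF 1) (tabulateF (addF (↑ MV) (# 0)) nV)) nilF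
    gates₂ = appendF gates₁ orF
    notF   = pairF (pairF (constF 3) (addF (addF nV MV) nilF)) nilF
    gates₃ = appendF gates₂ notF
    parityGate : Fin n → Gate M
    parityGate s = PARITY (tabulate (combine s))
    c₁ : Gates M (n + M)
    c₁ = layer inputs n parityGate
    c₂ : Gates M (1 + (n + M))
    c₂ = layer c₁ 1 (λ _ → OR (tabulate (new n)))

  blockStart-correct : ∀ f g {e} s → ⟦ f ⟧ e ≡ unary (suc l) → ⟦ g ⟧ e ≡ unary (toℕ s) →
                       ⟦ addF (mulF f g) nilF ⟧ e ≡ encodeWire (combine {n} {suc l} s zero)
  blockStart-correct f g s p q = wire-correct f g nilF s p q refl

  entry-correct : ∀ f g h {e} s u → ⟦ f ⟧ e ≡ unary (toℕ s) → ⟦ g ⟧ e ≡ unary (toℕ u) → ⟦ h ⟧ e ≡ encodeList (tabulate row) →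
                  truth (⟦ atF f (atF g h) ⟧ e) ≡ adj S s u
  entry-correct f g h s u p q r = trans
    (cong truth (atF-tabulate f (atF g h) s (λ s → encodeBool (adj S s u)) p (atF-tabulate g h u row q r)))
    (truth-encodeBool (adj S s u))

  _∙∙_ : Fin n → Fin m → Tree
  s ∙∙ u = unary (toℕ s) ∙ unary (toℕ u) ∙ E

  patF-correct : ∀ s u → truth (⟦ patF ⟧ (s ∙∙ u)) ≡ pat s u
  patF-correct s u = trans (cong truth (ifF-correct (dropF (↑ ↑ nV) (↑ ↑ binV)) adjF codeF {s ∙∙ u} (n <ᵇ length (bin m))
      (trans (cong truth (dropF-correct (↑ ↑ nV) (↑ ↑ binV) {s ∙∙ u} n refl)) (truth-drop (bin m) n)) refl refl))
    (if-truth (n <ᵇ length (bin m)) (entry-correct (# 0) (# 1) (↑ ↑ rowsV) {s ∙∙ u} s u refl refl refl)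
      (trans (cong (truth ∘ left) (trans (dropF-correct (# 0) (binF (sucF (# 1))) {s ∙∙ u} (toℕ s) refl)
                                         (cong (drop (toℕ s)) (binF-correct (sucF (# 1)) {s ∙∙ u} (suc (toℕ u)) refl))))
             (truth-left-drop (bin (suc (toℕ u))) (toℕ s))))
    where
    codeF : Fun
    codeF = atF (# 0) (binF (sucF (# 1)))
    if-truth : ∀ b {y z y′ z′} → truth y ≡ y′ → truth z ≡ z′ → truth (if b then y else z) ≡ (if b then y′ else z′)
    if-truth true  p q = p
    if-truth false p q = q

  notGate-correct : ∀ s → ⟦ notGateF ⟧ (unary (toℕ s) ∙ E) ≡ encodeGate {M} (NOT (combine s zero))
  notGate-correct s = cong (unary 3 ∙_) (blockStart-correct (↑ lV) (# 0) {unary (toℕ s) ∙ E} s refl refl)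

  picked-wires : ∀ f {e} {w k : ℕ} (C : Fin k → Bool) (h : Fin k → Fin w) → ⟦ f ⟧ e ≡ encodeList (pick C (encodeWire ∘ h)) →
                 ⟦ f ⟧ e ≡ encodeList (map encodeWire (pick C h))
  picked-wires f C h eq = trans eq (cong encodeList (sym (map-pick encodeWire C h)))

  matchGate-correct : ∀ u → ⟦ matchGateF ⟧ (unary (toℕ u) ∙ E) ≡ encodeGate (matchGate u)
  matchGate-correct u = cong (unary 0 ∙_) (picked-wires (pickF careF literalF (↑ nV)) care literal
    (pickF-correct careF literalF (↑ nV) {unary (toℕ u) ∙ E} care (encodeWire ∘ literal) refl
      (λ s → trans (cong truth (dropF-correct (# 0) (↑ ↑ binV) {s ∙∙ u} (toℕ s) refl)) (truth-drop (bin m) (toℕ s)))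
      (λ s → trans (ifF-correct patF posF negF {s ∙∙ u} (pat s u) (patF-correct s u)
                      (trans (blockStart-correct (↑ ↑ lV) (# 0) {s ∙∙ u} s refl refl) (cong unary (sym (toℕ-old n _))))
                      (new-correct (↑ ↑ MV) (# 0) {s ∙∙ u} n s refl refl))
                   (if-wire (pat s u)))))
    where
    careF posF negF literalF : Fun
    careF = dropF (# 0) (↑ ↑ binV)
    posF = addF (mulF (↑ ↑ lV) (# 0)) nilF
    negF = addF (↑ ↑ MV) (# 0)
    literalF = ifF patF posF negF
    literal : Fin n → Fin (n + M)
    literal s = if pat s u then old n (combine s zero) else new n s
    if-wire : ∀ {w} {i j : Fin w} b → (if b then encodeWire i else encodeWire j) ≡ encodeWire (if b then i else j)
    if-wire true  = refl
    if-wire false = refl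

  shiftGate-correct : ∀ s → ⟦ shiftGateF ⟧ (unary (toℕ s) ∙ E) ≡ encodeGate (shiftGate s)
  shiftGate-correct s = cong (unary 1 ∙_) (picked-wires (pickF entryF wireF (↑ mV)) (adj S s) (new {n + M} m)
    (pickF-correct entryF wireF (↑ mV) {unary (toℕ s) ∙ E} (adj S s) (encodeWire ∘ new {n + M} m) refl
      (λ u → entry-correct (# 1) (# 0) (↑ ↑ rowsV) {unary (toℕ u) ∙ unary (toℕ s) ∙ E} s u refl refl refl)
      (λ u → new-correct (addF (↑ ↑ nV) (↑ ↑ MV)) (# 0) {unary (toℕ u) ∙ unary (toℕ s) ∙ E} m u
               (M-wire (↑ ↑ nV) (↑ ↑ MV) {unary (toℕ u) ∙ unary (toℕ s) ∙ E} refl refl) refl)))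
    where
    entryF wireF : Fun
    entryF = atF (# 1) (atF (# 0) (↑ ↑ rowsV))
    wireF = addF (addF (↑ ↑ nV) (↑ ↑ MV)) (# 0)

  offset-correct : ∀ f g h {e} → ⟦ f ⟧ e ≡ unary m → ⟦ g ⟧ e ≡ unary n → ⟦ h ⟧ e ≡ unary M →
                   ⟦ addF f (addF g h) ⟧ e ≡ unary (m + (n + M))
  offset-correct f g h p q r = addF-correct f (addF g h) m (n + M) p (M-wire g h q r)

  outGate-correct : ∀ s → ⟦ outGateF ⟧ (unary (toℕ s) ∙ E) ≡ encodeGate (outGate s)
  outGate-correct s = cong (unary 2 ∙_) (cong₂ _∙_
    (new-correct offsetF (# 0) {unary (toℕ s) ∙ E} n s (offset-correct (↑ mV) (↑ nV) (↑ MV) {unary (toℕ s) ∙ E} refl refl refl) refl)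
    (wires-correct (tabulateF wireF (rightF ∘F ↑ lV)) l free
      (tabulateF-correct wireF (rightF ∘F ↑ lV) {unary (toℕ s) ∙ E} (encodeWire ∘ free) refl λ j →
        trans (wire-correct (↑ ↑ lV) (# 1) (sucF (# 0)) {unary (toℕ j) ∙ unary (toℕ s) ∙ E} s {suc j} refl refl refl)
              (cong unary (sym (toℕ-old³ (combine s (suc j))))))))
    where
    offsetF wireF : Fun
    offsetF = addF (↑ mV) (addF (↑ nV) (↑ MV))
    wireF = addF (mulF (↑ ↑ lV) (# 1)) (sucF (# 0))
    free : Fin l → Fin (n + (m + (n + M)))
    free j = old n (old m (old n (combine s (suc j))))
    toℕ-old³ : ∀ i → toℕ (old n (old m (old {M} n i))) ≡ toℕ i
    toℕ-old³ i = trans (toℕ-old n _) (trans (toℕ-old m _) (toℕ-old n i))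

  outWire-correct : ∀ s j → ⟦ outWireF ⟧ (unary (toℕ j) ∙ unary (toℕ s) ∙ E) ≡ encodeWire (out s j)
  outWire-correct s zero = new-correct (addF (↑ ↑ nV) offsetF) (# 1) {e} n s
    (addF-correct (↑ ↑ nV) offsetF {e} n (m + (n + M)) refl (offset-correct (↑ ↑ mV) (↑ ↑ nV) (↑ ↑ MV) {e} refl refl refl)) refl
    where
    offsetF : Fun
    offsetF = addF (↑ ↑ mV) (addF (↑ ↑ nV) (↑ ↑ MV))
    e : Tree
    e = nil ∙ unary (toℕ s) ∙ E
  outWire-correct s (suc j) = trans
    (wire-correct (↑ ↑ lV) (# 1) (# 0) {unary (suc (toℕ j)) ∙ unary (toℕ s) ∙ E} s {suc j} refl refl refl)
    (cong unary (sym (trans (toℕ-old n _) (trans (toℕ-old n _) (trans (toℕ-old m _) (toℕ-old n _))))))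

  generator-correct : ⟦ generatorF ⟧ E ≡ encodeCircuit generator
  generator-correct = cong₂ _∙_
    (gates-correct gates₄ outGates
      (next-layer gates₃ (tabulateF outGateF nV) shiftGates n outGate
        (next-layer gates₂ (tabulateF shiftGateF nV) matchGates n shiftGate
          (next-layer gates₁ (tabulateF matchGateF mV) notGates m matchGate
            (first-layer gates₁ n (λ s → NOT (combine s zero))
              (tabulateF-correct notGateF nV {E} (λ s → encodeGate {M} (NOT (combine s zero))) refl notGate-correct))
            (tabulateF-correct matchGateF mV (encodeGate ∘ matchGate) refl matchGate-correct))
          (tabulateF-correct shiftGateF nV (encodeGate ∘ shiftGate) refl shiftGate-correct))
        (tabulateF-correct outGateF nV (encodeGate ∘ outGate) refl outGate-correct)))
    (trans (concatF-correct (tabulateF blockF nV) (tabulate λ s → tabulate (encodeWire ∘ out s))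
             (trans (tabulateF-correct blockF nV {E} (λ s → encodeList (tabulate (encodeWire ∘ out s))) refl λ s →
                       tabulateF-correct outWireF (↑ lV) {unary (toℕ s) ∙ E} (encodeWire ∘ out s) refl (outWire-correct s))
                    (cong encodeList (sym (List.map-tabulate (λ s → tabulate (encodeWire ∘ out s)) encodeList)))))
           (cong encodeList (begin
             concat (tabulate λ s → tabulate (encodeWire ∘ out s))
               ≡⟨ cong concat (List.tabulate-cong λ s → List.map-tabulate (out s) encodeWire) ⟨
             concat (tabulate λ s → map encodeWire (tabulate (out s)))
               ≡⟨ cong concat (List.map-tabulate (λ s → tabulate (out s)) (map encodeWire)) ⟨
             concat (map (map encodeWire) (tabulate λ s → tabulate (out s)))
               ≡⟨ List.concat-map (tabulate λ s → tabulate (out s)) ⟩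
             map encodeWire (concat (tabulate λ s → tabulate (out s)))
               ≡⟨ cong (map encodeWire) (toList-blocks n out) ⟨
             map encodeWire (Vec.toList (Vec.concat (Vec.tabulate λ s → Vec.tabulate (out s)))) ∎)))
    where
    open ≡-Reasoning
    gates₁ gates₂ gates₃ gates₄ blockF : Fun
    gates₁ = tabulateF notGateF nV
    gates₂ = appendF gates₁ (tabulateF matchGateF mV)
    gates₃ = appendF gates₂ (tabulateF shiftGateF nV)
    gates₄ = appendF gates₃ (tabulateF outGateF nV)
    blockF = tabulateF outWireF (↑ lV)

  reduction-correct : ⟦ reductionF ⟧ (encodeInstance S ∙ unary (suc l)) ≡ encodeOutput (tester n (suc l)) generator
  reduction-correct = trans (cong ⟦ pairF testerF generatorF ⟧ bindings-correct) (cong₂ _∙_ tester-correct generator-correct)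
    where
    n′ m′ : Fun
    n′ = leftF ∘F leftF
    m′ = leftF ∘F rightF ∘F leftF
    x : Tree
    x = encodeInstance S ∙ unary (suc l)
    bindings-correct : ⟦ bindingsF ⟧ x ≡ E
    bindings-correct = cong₂ (λ t₁ t₂ → unary n ∙ unary m ∙ encodeList (tabulate row) ∙ unary (suc l) ∙ t₁ ∙ t₂)
      (mulF-correct n′ rightF {x} n (suc l) refl refl) (binF-correct m′ {x} m refl)

-- Counting on the cube

length-mono-⊆ : ∀ {a} {A : Set a} {xs ys : List A} → Unique xs → (∀ {x} → x List.∈ xs → x List.∈ ys) → length xs ≤ length ys
length-mono-⊆ [] sub = z≤n
length-mono-⊆ {xs = x ∷ xs} (x∉ ∷ uniq) sub with ∈-∃++ (sub (here refl))
... | us , vs , refl = ≤-trans (s≤s (length-mono-⊆ uniq rest))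
  (≤-reflexive (trans (cong suc (List.length-++ us)) (sym (trans (List.length-++ us) (+-suc (length us) (length vs))))))
  where
  rest : ∀ {y} → y List.∈ xs → y List.∈ us ++ vs
  rest {y} y∈ with ∈-++⁻ us (sub (there y∈))
  ... | inj₁ p            = ∈-++⁺ˡ p
  ... | inj₂ (here refl)  = ⊥-elim (All.lookup x∉ y∈ refl)
  ... | inj₂ (there p)    = ∈-++⁺ʳ us p

cube-unique : ∀ M → Unique (cube M)
cube-unique zero    = [] ∷ []
cube-unique (suc M) = Unique.++⁺ (Unique.map⁺ Vec.∷-injectiveʳ (cube-unique M)) (Unique.map⁺ Vec.∷-injectiveʳ (cube-unique M)) disjoint
  where
  disjoint : ∀ {v} → v List.∈ map (true ∷_) (cube M) × v List.∈ map (false ∷_) (cube M) → _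
  disjoint (p , q) with ∈-map⁻ (true ∷_) p | ∈-map⁻ (false ∷_) q
  ... | _ , _ , refl | _ , _ , ()

∈-cube : ∀ {M} (x : Bits M) → x List.∈ cube M
∈-cube []          = here refl
∈-cube (true ∷ x)  = ∈-++⁺ˡ (∈-map⁺ (true ∷_) (∈-cube x))
∈-cube (false ∷ x) = ∈-++⁺ʳ _ (∈-map⁺ (false ∷_) (∈-cube x))

count : ∀ {M} → (Bits M → Bool) → ℕ
count {M} A = length (filterᵇ A (cube M))

T⇒≡ : ∀ {b} → T b → b ≡ true
T⇒≡ = Equivalence.to T-≡

≡⇒T : ∀ {b} → b ≡ true → T b
≡⇒T = Equivalence.from T-≡

-- The preimage may be chosen from `r` in any way, since only `ψ` must be a fixed map. In the
-- application the preimage depends on a term and an uncovered element that `ψ` never sees.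
count-surjection : ∀ {M} (B A : Bits M → Bool) (ψ : Bits M → Bits M) →
                   (∀ r → B r ≡ true → ∃[ r′ ] A r′ ≡ true × ψ r′ ≡ r) → count B ≤ count A
count-surjection {M} B A ψ lift = subst (count B ≤_) (List.length-map ψ (filterᵇ A (cube M)))
  (length-mono-⊆ (Unique.filter⁺ (T? ∘ B) (cube-unique M)) λ {r} r∈ →
    let _ , Br = ∈-filter⁻ (T? ∘ B) {xs = cube M} r∈
        r′ , Ar′ , eq = lift r (T⇒≡ Br)
    in subst (List._∈ map ψ (filterᵇ A (cube M))) eq (∈-map⁺ ψ (∈-filter⁺ (T? ∘ A) (∈-cube r′) (≡⇒T Ar′))))

⟨_⟩ : Bool → ℕ
⟨ b ⟩ = if b then 1 else 0

tally : ∀ {k} → (Fin k → Bool) → ℕ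
tally p = sum (λ i → ⟨ p i ⟩)

total : ∀ {M} → (Bits M → ℕ) → ℕ
total {zero}  f = f []
total {suc M} f = total (f ∘ (true ∷_)) + total (f ∘ (false ∷_))

length-filterᵇ-map : ∀ {a} {A B : Set a} (p : B → Bool) (f : A → B) xs →
                     length (filterᵇ p (map f xs)) ≡ length (filterᵇ (p ∘ f) xs)
length-filterᵇ-map p f []       = refl
length-filterᵇ-map p f (x ∷ xs) with p (f x)
... | true  = cong suc (length-filterᵇ-map p f xs)
... | false = length-filterᵇ-map p f xs

count-suc : ∀ {M} (A : Bits (suc M) → Bool) → count A ≡ count (A ∘ (true ∷_)) + count (A ∘ (false ∷_))
count-suc {M} A = begin
  length (filterᵇ A (map (true ∷_) (cube M) ++ map (false ∷_) (cube M)))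
    ≡⟨ cong length (List.filter-++ (T? ∘ A) (map (true ∷_) (cube M)) _) ⟩
  length (filterᵇ A (map (true ∷_) (cube M)) ++ filterᵇ A (map (false ∷_) (cube M)))
    ≡⟨ List.length-++ (filterᵇ A (map (true ∷_) (cube M))) ⟩
  length (filterᵇ A (map (true ∷_) (cube M))) + length (filterᵇ A (map (false ∷_) (cube M)))
    ≡⟨ cong₂ _+_ (length-filterᵇ-map A (true ∷_) (cube M)) (length-filterᵇ-map A (false ∷_) (cube M)) ⟩
  count (A ∘ (true ∷_)) + count (A ∘ (false ∷_)) ∎
  where open ≡-Reasoning

count-total : ∀ {M} (A : Bits M → Bool) → count A ≡ total (λ r → ⟨ A r ⟩)
count-total {zero} A with A []
... | true  = refl
... | false = refl
count-total {suc M} A = trans (count-suc A) (cong₂ _+_ (count-total (A ∘ (true ∷_))) (count-total (A ∘ (false ∷_))))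

total-mono : ∀ {M} {f g : Bits M → ℕ} → (∀ r → f r ≤ g r) → total f ≤ total g
total-mono {zero}  f≤g = f≤g []
total-mono {suc M} f≤g = +-mono-≤ (total-mono (f≤g ∘ (true ∷_))) (total-mono (f≤g ∘ (false ∷_)))

+-interchange : ∀ a b c d → (a + b) + (c + d) ≡ (a + c) + (b + d)
+-interchange = solve-∀

total-+ : ∀ {M} (f g : Bits M → ℕ) → total (λ r → f r + g r) ≡ total f + total g
total-+ {zero}  f g = refl
total-+ {suc M} f g = trans (cong₂ _+_ (total-+ (f ∘ (true ∷_)) (g ∘ (true ∷_))) (total-+ (f ∘ (false ∷_)) (g ∘ (false ∷_))))
  (+-interchange (total (f ∘ (true ∷_))) _ _ _)

total-*ʳ : ∀ {M} (f : Bits M → ℕ) c → total (λ r → f r * c) ≡ total f * c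
total-*ʳ {zero}  f c = refl
total-*ʳ {suc M} f c = trans (cong₂ _+_ (total-*ʳ (f ∘ (true ∷_)) c) (total-*ʳ (f ∘ (false ∷_)) c))
  (sym (*-distribʳ-+ c (total (f ∘ (true ∷_))) _))

total-sum : ∀ {M k} (f : Fin k → Bits M → ℕ) → total (λ r → sum (λ j → f j r)) ≡ sum (λ j → total (f j))
total-sum {zero}  f = refl
total-sum {suc M} f = trans (cong₂ _+_ (total-sum (λ j → f j ∘ (true ∷_))) (total-sum (λ j → f j ∘ (false ∷_))))
  (sym (∑-distrib-+ (λ j → total (f j ∘ (true ∷_))) (λ j → total (f j ∘ (false ∷_)))))

-- The union bound with denominators cleared: `z / c` bounds each event.
count-any : ∀ {M} {A : Set} (P : A → Bits M → Bool) c z → (xs : List A) → (∀ x → count (P x) * c ≤ z) →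
            count (λ r → any (λ x → P x r) xs) * c ≤ length xs * z
count-any {M} P c z [] bound = subst (λ k → k * c ≤ 0) (sym (trans (count-total {M} (λ _ → false)) (zeros M))) z≤n
  where
  zeros : ∀ M → total {M} (λ _ → 0) ≡ 0
  zeros zero    = refl
  zeros (suc M) = cong₂ _+_ (zeros M) (zeros M)
count-any P c z (x ∷ xs) bound = begin
  count (λ r → P x r ∨ tail r) * c           ≤⟨ *-monoˡ-≤ c union ⟩
  (count (P x) + count tail) * c             ≡⟨ *-distribʳ-+ c (count (P x)) (count tail) ⟩
  count (P x) * c + count tail * c           ≤⟨ +-mono-≤ (bound x) (count-any P c z xs bound) ⟩
  z + length xs * z                          ∎
  where
  open ≤-Reasoning
  tail = λ r → any (λ x → P x r) xs
  ∨≤+ : ∀ a b → ⟨ a ∨ b ⟩ ≤ ⟨ a ⟩ + ⟨ b ⟩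
  ∨≤+ true  b = m≤m+n 1 _
  ∨≤+ false b = ≤-refl
  union : count (λ r → P x r ∨ tail r) ≤ count (P x) + count tail
  union = begin
    count (λ r → P x r ∨ tail r)                   ≡⟨ count-total (λ r → P x r ∨ tail r) ⟩
    total (λ r → ⟨ P x r ∨ tail r ⟩)               ≤⟨ total-mono (λ r → ∨≤+ (P x r) (tail r)) ⟩
    total (λ r → ⟨ P x r ⟩ + ⟨ tail r ⟩)           ≡⟨ total-+ _ (λ r → ⟨ tail r ⟩) ⟩
    total (λ r → ⟨ P x r ⟩) + total (λ r → ⟨ tail r ⟩) ≡⟨ cong₂ _+_ (count-total (P x)) (count-total tail) ⟨
    count (P x) + count tail                       ∎

sum-bounded : ∀ {k} (f : Fin k → ℕ) c → (∀ j → f j ≤ c) → sum f ≤ k * c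
sum-bounded {zero}  f c bound = z≤n
sum-bounded {suc k} f c bound = +-mono-≤ (bound zero) (sum-bounded (f ∘ suc) c (bound ∘ suc))

-- Counting pairs of a seed in `B` and an index `j` with `G j` gives at least `k / 2` per seed and
-- at most `c` per index.
count-doubleCount : ∀ {M k} .{{_ : NonZero k}} (B : Bits M → Bool) (G : Fin k → Bits M → Bool) c →
  (∀ r → B r ≡ true → k ≤ 2 * tally (λ j → G j r)) → (∀ j → count (G j) ≤ c) → count B ≤ 2 * c
count-doubleCount {M} {k} B G c many bound = *-cancelʳ-≤ (count B) (2 * c) (k) (begin
  count B * k                            ≡⟨ cong (_* k) (count-total B) ⟩
  total (λ r → ⟨ B r ⟩) * k              ≡⟨ total-*ʳ (λ r → ⟨ B r ⟩) (k) ⟨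
  total (λ r → ⟨ B r ⟩ * k)              ≤⟨ total-mono pointwise ⟩
  total (λ r → tally (λ j → G j r) * 2)      ≡⟨ total-*ʳ (λ r → tally (λ j → G j r)) 2 ⟩
  total (λ r → tally (λ j → G j r)) * 2      ≡⟨ cong (_* 2) (total-sum (λ j r → ⟨ G j r ⟩)) ⟩
  sum (λ j → total (λ r → ⟨ G j r ⟩)) * 2    ≤⟨ *-monoˡ-≤ 2 (sum-bounded _ c (λ j → subst (_≤ c) (count-total (G j)) (bound j))) ⟩
  k * c * 2                              ≡⟨ rearrange (k) c ⟩
  2 * c * k                              ∎)
  where
  open ≤-Reasoning
  rearrange : ∀ k c → k * c * 2 ≡ 2 * c * k
  rearrange = solve-∀
  pointwise : ∀ r → ⟨ B r ⟩ * k ≤ tally (λ j → G j r) * 2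
  pointwise r with B r in eq
  ... | false = z≤n
  ... | true  = subst₂ _≤_ (sym (*-identityˡ (k))) (*-comm 2 (tally (λ j → G j r))) (many r eq)

satisfiable? : ∀ {M} (A : Bits M → Bool) → count A ≡ 0 ⊎ (∃[ r ] A r ≡ true)
satisfiable? {M} A with filterᵇ A (cube M) in eq
... | []    = inj₁ refl
... | r ∷ _ = inj₂ (r , T⇒≡ (proj₂ (∈-filter⁻ (T? ∘ A) {xs = cube M} (subst (r List.∈_) (sym eq) (here refl)))))

unsatisfiable : ∀ {M} (A : Bits M → Bool) → (∀ r → A r ≢ true) → count A ≡ 0
unsatisfiable A none with satisfiable? A
... | inj₁ eq       = eq
... | inj₂ (r , Ar) = ⊥-elim (none r Ar)

-- `B` lies in a subcube of codimension `tally J`. The fixed values are not given; agreement alone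
-- ensures that at a coordinate of `J` only one half of the cube meets `B`.
count-agreeing : ∀ {M} (B : Bits M → Bool) (J : Fin M → Bool) →
  (∀ r r′ → B r ≡ true → B r′ ≡ true → ∀ i → J i ≡ true → lookup r i ≡ lookup r′ i) → count B * 2 ^ tally J ≤ 2 ^ M
count-agreeing {zero} B J agree with B []
... | true  = ≤-refl
... | false = z≤n
count-agreeing {suc M} B J agree with J zero in eq
... | false = begin
  count B * 2 ^ t                ≡⟨ cong (_* 2 ^ t) (count-suc B) ⟩
  (c₁ + c₀) * 2 ^ t              ≡⟨ *-distribʳ-+ (2 ^ t) c₁ c₀ ⟩
  c₁ * 2 ^ t + c₀ * 2 ^ t        ≤⟨ +-mono-≤ (below true) (below false) ⟩
  2 ^ M + 2 ^ M                  ≡⟨ cong (2 ^ M +_) (+-identityʳ (2 ^ M)) ⟨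
  2 ^ suc M                      ∎
  where
  open ≤-Reasoning
  t = tally (J ∘ suc)
  c₁ = count (B ∘ (true ∷_))
  c₀ = count (B ∘ (false ∷_))
  below : ∀ b → count (B ∘ (b ∷_)) * 2 ^ t ≤ 2 ^ M
  below b = count-agreeing (B ∘ (b ∷_)) (J ∘ suc) λ r r′ Br Br′ i → agree (b ∷ r) (b ∷ r′) Br Br′ (suc i)
... | true = begin
  count B * (2 * 2 ^ t)          ≡⟨ cong (_* (2 * 2 ^ t)) (count-suc B) ⟩
  (c₁ + c₀) * (2 * 2 ^ t)        ≡⟨ rearrange (c₁ + c₀) (2 ^ t) ⟩
  2 * ((c₁ + c₀) * 2 ^ t)        ≤⟨ *-monoʳ-≤ 2 one-half ⟩
  2 ^ suc M                      ∎
  where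
  open ≤-Reasoning
  rearrange : ∀ c t → c * (2 * t) ≡ 2 * (c * t)
  rearrange = solve-∀
  t = tally (J ∘ suc)
  c₁ = count (B ∘ (true ∷_))
  c₀ = count (B ∘ (false ∷_))
  below : ∀ b → count (B ∘ (b ∷_)) * 2 ^ t ≤ 2 ^ M
  below b = count-agreeing (B ∘ (b ∷_)) (J ∘ suc) λ r r′ Br Br′ i → agree (b ∷ r) (b ∷ r′) Br Br′ (suc i)
  one-half : (c₁ + c₀) * 2 ^ t ≤ 2 ^ M
  one-half with satisfiable? (B ∘ (true ∷_))
  ... | inj₁ c₁≡0 rewrite c₁≡0 = below false
  ... | inj₂ (r , Br) = subst (λ c → c * 2 ^ t ≤ 2 ^ M)
    (sym (trans (cong (c₁ +_) (unsatisfiable (B ∘ (false ∷_)) λ r′ Br′ → clash (agree (true ∷ r) (false ∷ r′) Br Br′ zero eq)))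
                (+-identityʳ c₁))) (below true)
    where
    clash : true ≢ false
    clash ()

vanishing : ∀ {M} → (Fin M → Bool) → Bits M → Bool
vanishing J []      = true
vanishing J (b ∷ r) = not (J zero ∧ b) ∧ vanishing (J ∘ suc) r

vanishing⁻ : ∀ {M} (J : Fin M → Bool) r → vanishing J r ≡ true → ∀ i → J i ≡ true → lookup r i ≡ false
vanishing⁻ J (b ∷ r) van i Ji with J zero in eq | b | van | i | Ji
... | true  | false | _   | zero  | _  = refl
... | true  | true  | ()  | _     | _
... | false | _     | _   | zero  | J0 with () ← trans (sym eq) J0
... | true  | false | van | suc i | Ji = vanishing⁻ (J ∘ suc) r van i Ji
... | false | _     | van | suc i | Ji = vanishing⁻ (J ∘ suc) r van i Ji

vanishing-count : ∀ {M} (J : Fin M → Bool) → 2 ^ M ≤ count (vanishing J) * 2 ^ tally J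
vanishing-count {zero} J = ≤-refl
vanishing-count {suc M} J with J zero in eq
... | false = begin
  2 ^ M + (2 ^ M + 0)                ≡⟨ cong (2 ^ M +_) (+-identityʳ (2 ^ M)) ⟩
  2 ^ M + 2 ^ M                      ≤⟨ +-mono-≤ (vanishing-count (J ∘ suc)) (vanishing-count (J ∘ suc)) ⟩
  c * 2 ^ t + c * 2 ^ t              ≡⟨ *-distribʳ-+ (2 ^ t) c c ⟨
  (c + c) * 2 ^ t                    ≡⟨ cong (_* 2 ^ t) (trans (count-suc (vanishing J)) (cong₂ _+_ (branch-false true) (branch-false false))) ⟨
  count (vanishing J) * 2 ^ t        ∎
  where
  open ≤-Reasoning
  t = tally (J ∘ suc)
  c = count (vanishing (J ∘ suc))
  branch-false : ∀ b → count (vanishing J ∘ (b ∷_)) ≡ c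
  branch-false b rewrite eq = refl
... | true = begin
  2 * 2 ^ M                          ≤⟨ *-monoʳ-≤ 2 (vanishing-count (J ∘ suc)) ⟩
  2 * (c * 2 ^ t)                    ≡⟨ rearrange c (2 ^ t) ⟩
  c * (2 * 2 ^ t)                    ≤⟨ *-monoˡ-≤ (2 * 2 ^ t) (≤-trans (≤-reflexive (sym branch-true))
                                          (≤-trans (m≤n+m _ (count (vanishing J ∘ (true ∷_)))) (≤-reflexive (sym (count-suc (vanishing J)))))) ⟩
  count (vanishing J) * (2 * 2 ^ t)  ∎
  where
  open ≤-Reasoning
  t = tally (J ∘ suc)
  c = count (vanishing (J ∘ suc))
  rearrange : ∀ c t → 2 * (c * t) ≡ c * (2 * t)
  rearrange = solve-∀
  branch-true : count (vanishing J ∘ (false ∷_)) ≡ c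
  branch-true rewrite eq = refl

-- Sums over blocks and Boolean identities

sum-↑ : ∀ a {b} (f : Fin (a + b) → ℕ) → sum f ≡ sum (λ i → f (i ↑ˡ b)) + sum (λ j → f (a ↑ʳ j))
sum-↑ zero    f = refl
sum-↑ (suc a) f = trans (cong (f zero +_) (sum-↑ a (f ∘ suc))) (sym (+-assoc (f zero) _ _))

sum-combine : ∀ n {l} (f : Fin (n * l) → ℕ) → sum f ≡ sum (λ s → sum (λ j → f (combine {n} {l} s j)))
sum-combine zero        f = refl
sum-combine (suc n) {l} f = trans (sum-↑ l f) (cong (sum (λ j → f (j ↑ˡ (n * l))) +_) (sum-combine n (f ∘ (l ↑ʳ_))))

sum-mono : ∀ {k} {f g : Fin k → ℕ} → (∀ i → f i ≤ g i) → sum f ≤ sum g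
sum-mono {zero}  f≤g = z≤n
sum-mono {suc k} f≤g = +-mono-≤ (f≤g zero) (sum-mono (f≤g ∘ suc))

sum-bounded-below : ∀ {k} (f : Fin k → ℕ) c → (∀ j → c ≤ f j) → k * c ≤ sum f
sum-bounded-below {zero}  f c bound = z≤n
sum-bounded-below {suc k} f c bound = +-mono-≤ (bound zero) (sum-bounded-below (f ∘ suc) c (bound ∘ suc))

sum-*ʳ : ∀ {k} (f : Fin k → ℕ) c → sum (λ j → f j * c) ≡ sum f * c
sum-*ʳ {zero}  f c = refl
sum-*ʳ {suc k} f c = trans (cong (f zero * c +_) (sum-*ʳ (f ∘ suc) c)) (sym (*-distribʳ-+ c (f zero) _))

⟨⟩-mono : ∀ {a b} → (a ≡ true → b ≡ true) → ⟨ a ⟩ ≤ ⟨ b ⟩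
⟨⟩-mono {false} f = z≤n
⟨⟩-mono {true}  f rewrite f refl = ≤-refl

tally-mono : ∀ {k} {p q : Fin k → Bool} → (∀ i → p i ≡ true → q i ≡ true) → tally p ≤ tally q
tally-mono p⊆q = sum-mono λ i → ⟨⟩-mono (p⊆q i)

tally-tabulate : ∀ {k} (p : Fin k → Bool) → ∣ Vec.tabulate p ∣ ≡ tally p
tally-tabulate {zero}  p = refl
tally-tabulate {suc k} p with p zero
... | true  = cong suc (tally-tabulate (p ∘ suc))
... | false = tally-tabulate (p ∘ suc)

onBlocks : ∀ n {l} {A : Set} → (Fin n → Fin l → A) → Fin (n * l) → A
onBlocks n {l} p i = uncurry p (remQuot {n} l i)

onBlocks-combine : ∀ n {l} {A : Set} (p : Fin n → Fin l → A) s j → onBlocks n p (combine s j) ≡ p s j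
onBlocks-combine n p s j = cong (uncurry p) (remQuot-combine s j)

fromBlocks : ∀ n {l} → (Fin n → Fin l → Bool) → Bits (n * l)
fromBlocks n p = Vec.tabulate (onBlocks n p)

bit-fromBlocks : ∀ n {l} (p : Fin n → Fin l → Bool) s j → bit n (fromBlocks n p) s j ≡ p s j
bit-fromBlocks n p s j = trans (Vec.lookup∘tabulate (onBlocks n p) (combine s j)) (onBlocks-combine n p s j)

tally-onBlocks : ∀ n {l} (p : Fin n → Fin l → Bool) → tally (onBlocks n p) ≡ sum (λ s → tally (p s))
tally-onBlocks n p = trans (sum-combine n _) (sum-cong-≗ λ s → sum-cong-≗ λ j → cong ⟨_⟩ (onBlocks-combine n p s j))

by-blocks : ∀ n {l} (P : Fin (n * l) → Set) → (∀ s j → P (combine s j)) → ∀ i → P i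
by-blocks n {l} P h i = subst P (combine-remQuot {n} l i) (h (proj₁ (remQuot {n} l i)) (proj₂ (remQuot {n} l i)))

bits-ext : ∀ n {l} {x y : Bits (n * l)} → (∀ s j → bit n x s j ≡ bit n y s j) → x ≡ y
bits-ext n {x = x} {y} eq = Pointwise-≡⇒≡ (ext (by-blocks n (λ i → lookup x i ≡ lookup y i) eq))

⇔⇒≡ : ∀ {a b} → (a ≡ true → b ≡ true) → (b ≡ true → a ≡ true) → a ≡ b
⇔⇒≡ {true}          f g = sym (f refl)
⇔⇒≡ {false} {false} f g = refl
⇔⇒≡ {false} {true}  f g = g refl

-- The contradiction is a bit that is both false and true, the shape in which clashing selector
-- values arise.
≢true⇒≡false : ∀ {b} → (b ≡ true → ∃[ x ] x ≡ false × x ≡ true) → b ≡ false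
≢true⇒≡false {false} f = refl
≢true⇒≡false {true}  f with f refl
... | _ , refl , ()

∧-true : ∀ {a b} → a ∧ b ≡ true → a ≡ true × b ≡ true
∧-true {true} eq = refl , eq

and-pick⁻ : ∀ {k} c (h : Fin k → Bool) → and (pick c h) ≡ true → ∀ i → c i ≡ true → h i ≡ true
and-pick⁻ {suc k} c h eq i ci with c zero in eq₀
and-pick⁻ {suc k} c h eq i ci       | true with h zero in eqh
and-pick⁻ {suc k} c h eq zero ci    | true | true = eqh
and-pick⁻ {suc k} c h eq (suc i) ci | true | true = and-pick⁻ (c ∘ suc) (h ∘ suc) eq i ci
and-pick⁻ {suc k} c h eq zero ci    | false with () ← trans (sym ci) eq₀
and-pick⁻ {suc k} c h eq (suc i) ci | false = and-pick⁻ (c ∘ suc) (h ∘ suc) eq i ci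

and-pick⁺ : ∀ {k} c (h : Fin k → Bool) → (∀ i → c i ≡ true → h i ≡ true) → and (pick c h) ≡ true
and-pick⁺ {zero}  c h all = refl
and-pick⁺ {suc k} c h all with c zero | all zero
... | true  | h₀ rewrite h₀ refl = and-pick⁺ (c ∘ suc) (h ∘ suc) (all ∘ suc)
... | false | _  = and-pick⁺ (c ∘ suc) (h ∘ suc) (all ∘ suc)

or-pick⁻ : ∀ {k} c (h : Fin k → Bool) → or (pick c h) ≡ true → ∃[ i ] c i ≡ true × h i ≡ true
or-pick⁻ {suc k} c h eq with c zero in eq₀ | h zero in eqh
... | true  | true  = zero , eq₀ , eqh
... | true  | false = let i , p , q = or-pick⁻ (c ∘ suc) (h ∘ suc) eq in suc i , p , q
... | false | _     = let i , p , q = or-pick⁻ (c ∘ suc) (h ∘ suc) eq in suc i , p , q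

∨-true⁺ʳ : ∀ a {b} → b ≡ true → a ∨ b ≡ true
∨-true⁺ʳ true  eq = refl
∨-true⁺ʳ false eq = eq

or-pick⁺ : ∀ {k} c (h : Fin k → Bool) i → c i ≡ true → h i ≡ true → or (pick c h) ≡ true
or-pick⁺ {suc k} c h zero ci hi rewrite ci | hi = refl
or-pick⁺ {suc k} c h (suc i) ci hi with c zero
... | true  = ∨-true⁺ʳ (h zero) (or-pick⁺ (c ∘ suc) (h ∘ suc) i ci hi)
... | false = or-pick⁺ (c ∘ suc) (h ∘ suc) i ci hi

or-tabulate⁺ : ∀ {k} (h : Fin k → Bool) i → h i ≡ true → or (tabulate h) ≡ true
or-tabulate⁺ h zero    eq rewrite eq = refl
or-tabulate⁺ h (suc i) eq = ∨-true⁺ʳ (h zero) (or-tabulate⁺ (h ∘ suc) i eq)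

or-tabulate⁻ : ∀ {k} (h : Fin k → Bool) → or (tabulate h) ≡ true → ∃[ i ] h i ≡ true
or-tabulate⁻ {suc k} h eq with h zero in eq₀
... | true  = zero , eq₀
... | false = let i , p = or-tabulate⁻ (h ∘ suc) eq in suc i , p

xor-cancelʳ : ∀ a b → (a xor b) xor b ≡ a
xor-cancelʳ a b = trans (xor-assoc a b b) (trans (cong (a xor_) (xor-same b)) (xor-identityʳ a))

parity-cong : ∀ {k} {g h : Fin k → Bool} → (∀ i → g i ≡ h i) → parity g ≡ parity h
parity-cong eq = cong (foldr _xor_ false) (List.tabulate-cong eq)

parity-flip : ∀ {k} (g : Fin k → Bool) j a → parity (λ i → g i xor (does (i ≟ᶠ j) ∧ a)) ≡ parity g xor a
parity-flip g zero a = begin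
  (g zero xor a) xor parity (λ i → g (suc i) xor false) ≡⟨ cong ((g zero xor a) xor_) (parity-cong λ i → xor-identityʳ (g (suc i))) ⟩
  (g zero xor a) xor parity (g ∘ suc)                   ≡⟨ xor-assoc (g zero) a _ ⟩
  g zero xor (a xor parity (g ∘ suc))                   ≡⟨ cong (g zero xor_) (xor-comm a _) ⟩
  g zero xor (parity (g ∘ suc) xor a)                   ≡⟨ xor-assoc (g zero) _ a ⟨
  (g zero xor parity (g ∘ suc)) xor a                   ∎
  where open ≡-Reasoning
parity-flip g (suc j) a = trans (cong₂ _xor_ (xor-identityʳ (g zero)) (parity-flip (g ∘ suc) j a))
  (sym (xor-assoc (g zero) (parity (g ∘ suc)) a))

-- Terms and the variables that they mention

variableOf : ∀ {M} → Literal M → Fin M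
variableOf (pos i) = i
variableOf (neg i) = i

mentions : ∀ {M} → Term M → Fin M → Bool
mentions T i = any (λ λ′ → does (variableOf λ′ ≟ᶠ i)) T

accepts : ∀ {M} → Bits M → Term M → Bool
accepts x = all (evalLiteral x)

does-refl : ∀ {k} (i : Fin k) → does (i ≟ᶠ i) ≡ true
does-refl i with i ≟ᶠ i
... | yes _ = refl
... | no i≢i = ⊥-elim (i≢i refl)

does-true : ∀ {k} {i j : Fin k} → does (i ≟ᶠ j) ≡ true → i ≡ j
does-true {i = i} {j} eq with i ≟ᶠ j
... | yes p = p

evalLiteral-local : ∀ {M} {x y : Bits M} L → lookup x (variableOf L) ≡ lookup y (variableOf L) → evalLiteral x L ≡ evalLiteral y L
evalLiteral-local (pos i) eq = eq
evalLiteral-local (neg i) eq = cong not eq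

evalLiteral-injective : ∀ {M} {x y : Bits M} L → evalLiteral x L ≡ evalLiteral y L → lookup x (variableOf L) ≡ lookup y (variableOf L)
evalLiteral-injective (pos i) eq = eq
evalLiteral-injective {x = x} {y} (neg i) eq with lookup x i | lookup y i
... | true  | true  = refl
... | false | false = refl

accepts-local : ∀ {M} {x y : Bits M} T → (∀ i → mentions T i ≡ true → lookup x i ≡ lookup y i) → accepts x T ≡ accepts y T
accepts-local []      eq = refl
accepts-local (L ∷ T) eq = cong₂ _∧_
  (evalLiteral-local L (eq (variableOf L) (cong (_∨ mentions T (variableOf L)) (does-refl (variableOf L)))))
  (accepts-local T λ i i∈ → eq i (∨-true⁺ʳ _ i∈))

-- Acceptance makes every literal true, and the truth of a literal determines its variable.
accepts-agree : ∀ {M} {x y : Bits M} T → accepts x T ≡ true → accepts y T ≡ true → ∀ i → mentions T i ≡ true → lookup x i ≡ lookup y i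
accepts-agree {x = x} {y} (L ∷ T) px py i i∈ with ∧-true px | ∧-true py | does (variableOf L ≟ᶠ i) in eq | i∈
... | lx , tx | ly , ty | false | i∈T = accepts-agree T tx ty i i∈T
... | lx , tx | ly , ty | true  | _   = subst (λ k → lookup x k ≡ lookup y k) (does-true eq) (evalLiteral-injective L (trans lx (sym ly)))

-- The last component replaces membership of the witness: it lets the same term be reused for
-- another predicate or another input.
any⁻ : ∀ {A : Set} (p : A → Bool) xs → any p xs ≡ true → ∃[ x ] p x ≡ true × (∀ q → q x ≡ true → any q xs ≡ true)
any⁻ p (x ∷ xs) eq with p x in eq₀
... | true  = x , eq₀ , λ q qx → cong (_∨ any q xs) qx
... | false = let y , py , up = any⁻ p xs eq in y , py , λ q qy → ∨-true⁺ʳ (q x) (up q qy)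

-- Juntas and hardness

blockwise : ∀ {n} l → Subset n → Subset (n * l)
blockwise l C = Vec.concat (Vec.map (Vec.replicate l) C)

lookup-blockwise : ∀ {n l} (C : Subset n) s (j : Fin l) → lookup (blockwise l C) (combine s j) ≡ lookup C s
lookup-blockwise {l = l} C s j = trans (Vec.lookup-concat (Vec.map (Vec.replicate l) C) s j)
  (trans (cong (λ v → lookup v j) (Vec.lookup-map s (Vec.replicate l) C)) (Vec.lookup-replicate j (lookup C s)))

∣blockwise∣ : ∀ {n} l (C : Subset n) → ∣ blockwise l C ∣ ≡ ∣ C ∣ * l
∣blockwise∣ l []      = refl
∣blockwise∣ l (true  ∷ C) = trans (inside++ l (blockwise l C)) (cong (l +_) (∣blockwise∣ l C))
  where
  inside++ : ∀ k {m} (D : Subset m) → ∣ Vec.replicate k true Vec.++ D ∣ ≡ k + ∣ D ∣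
  inside++ zero    D = refl
  inside++ (suc k) D = cong suc (inside++ k D)
∣blockwise∣ l (false ∷ C) = trans (outside++ l (blockwise l C)) (∣blockwise∣ l C)
  where
  outside++ : ∀ k {m} (D : Subset m) → ∣ Vec.replicate k false Vec.++ D ∣ ≡ ∣ D ∣
  outside++ zero    D = refl
  outside++ (suc k) D = outside++ k D

n²≤m²⇒n≤m : ∀ n m → n * n ≤ m * m → n ≤ m
n²≤m²⇒n≤m n m n²≤m² with ≤-<-connex n m
... | inj₁ n≤m = n≤m
... | inj₂ m<n = ⊥-elim (<⇒≱ (*-mono-< m<n m<n) n²≤m²)

0/d≃0 : ∀ c d .{{_ : NonZero d}} → c ≡ 0 → (ℤ.+ c / d) ≃ 0ℚᵘ
0/d≃0 .0 (suc d) refl = *≡* refl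

Pr-zero : ∀ {M} (A : Bits M → Bool) → count A ≡ 0 → Pr A ≃ 0ℚᵘ
Pr-zero {M} A eq = 0/d≃0 (count A) (2 ^ M) {{m^n≢0 2 M}} eq

-- For any assignment of selector patterns to the elements that separates
-- elements with different neighbourhoods from each other and from zero.
module Reduction (S : Instance) (l : ℕ) (pat : Fin (#sets S) → Fin (#elems S) → Bool) (care : Fin (#sets S) → Bool)
  (pat-nonzero : ∀ u → ∃[ s ] care s ≡ true × pat s u ≡ true)
  (pat-separates : ∀ u u′ → (∀ s → care s ≡ true → pat s u ≡ pat s u′) → ∀ s → adj S s u ≡ adj S s u′) where

  n m : ℕ
  n = #sets S
  m = #elems S

  open Generator n m l (adj S) pat care

  f : Bits M → Bool
  f = eval₁ (tester n (suc l))

  G : Bits M → Bits M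
  G = eval generator

  parity-G : ∀ r s → parity (bit n (G r) s) ≡ shift r s
  parity-G r s = trans (cong₂ _xor_ (generator-parity r s) (parity-cong (generator-free r s)))
    (xor-cancelʳ (shift r s) (parity (λ j → bit n r s (suc j))))

  f-G : ∀ r → f (G r) ≡ not (or (tabulate (shift r)))
  f-G r = trans (eval-tester n (suc l) (G r)) (cong (λ l → not (or l)) (List.tabulate-cong (parity-G r)))

  lookup-∈ : ∀ {C : Subset n} {s} → s ∈ C → lookup C s ≡ true
  lookup-∈ = Vec.[]=⇒lookup

  -- An odd block means that the selectors match some `u`. Then the block of every set containing
  -- `u` is odd, and the cover has such a set; so the blocks of `C` already reveal whether all
  -- blocks are even.
  junta : ∀ C k → IsCover S C → ∣ C ∣ ≤ k → JuntaUnder G (k * suc l) f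
  junta C k cover C≤k = g , (blockwise (suc l) C , size≤ , depends) , zero-dist
    where
    g : Bits M → Bool
    g x = not (or (pick (lookup C) λ s → parity (bit n x s)))
    size≤ : ∣ blockwise (suc l) C ∣ ≤ k * suc l
    size≤ = subst (_≤ k * suc l) (sym (∣blockwise∣ (suc l) C)) (*-monoˡ-≤ (suc l) C≤k)
    depends : ∀ x y → (∀ i → i ∈ blockwise (suc l) C → lookup x i ≡ lookup y i) → g x ≡ g y
    depends x y eq = cong (not ∘ or) (pick-cong (lookup C) λ s s∈ → parity-cong λ j →
      eq (combine s j) (Vec.lookup⇒[]= (combine s j) (blockwise (suc l) C) (trans (lookup-blockwise C s j) s∈)))
    agree : ∀ r → g (G r) ≡ f (G r)
    agree r = begin
      g (G r)                                  ≡⟨ cong (not ∘ or) (pick-cong (lookup C) λ s _ → parity-G r s) ⟩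
      not (or (pick (lookup C) (shift r)))     ≡⟨ cong not (⇔⇒≡ forth back) ⟩
      not (or (tabulate (shift r)))            ≡⟨ f-G r ⟨
      f (G r)                                  ∎
      where
      open ≡-Reasoning
      forth : or (pick (lookup C) (shift r)) ≡ true → or (tabulate (shift r)) ≡ true
      forth eq = let s , _ , p = or-pick⁻ (lookup C) (shift r) eq in or-tabulate⁺ (shift r) s p
      back : or (tabulate (shift r)) ≡ true → or (pick (lookup C) (shift r)) ≡ true
      back eq = let s , p         = or-tabulate⁻ (shift r) eq
                    u , _ , hit   = or-pick⁻ (adj S s) (match r) p
                    s′ , s′∈ , su = cover u
                in or-pick⁺ (lookup C) (shift r) s′ (lookup-∈ s′∈) (or-pick⁺ (adj S s′) (match r) u su hit)
    zero-dist : dist G g f ≃ 0ℚᵘ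
    zero-dist = Pr-zero (λ r → g (G r) xor f (G r)) (unsatisfiable _ λ r →
      ≡⇒xor≢true (agree r))
      where
      ≡⇒xor≢true : ∀ {a b} → a ≡ b → a xor b ≢ true
      ≡⇒xor≢true {true}  refl ()
      ≡⇒xor≢true {false} refl ()

  zeroBlock : Fin n → Fin (suc l) → Bool
  zeroBlock s zero    = care s
  zeroBlock s (suc _) = false

  zeroMask : Fin M → Bool
  zeroMask = onBlocks n zeroBlock

  -- Seeds whose selectors encode no element, so that all blocks of the output are even.
  even : Bits M → Bool
  even = vanishing zeroMask

  even-selector : ∀ r → even r ≡ true → ∀ s → care s ≡ true → bit n r s zero ≡ false
  even-selector r er s cs = vanishing⁻ zeroMask r er (combine s zero) (trans (onBlocks-combine n zeroBlock s zero) cs)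

  literal-true : ∀ p b → (if p then b else not b) ≡ true → b ≡ p
  literal-true true  b     eq = eq
  literal-true false false eq = refl

  literal-refl : ∀ p b → b ≡ p → (if p then b else not b) ≡ true
  literal-refl true  b eq = eq
  literal-refl false b eq = cong not eq

  match⁻ : ∀ r u → match r u ≡ true → ∀ s → care s ≡ true → bit n r s zero ≡ pat s u
  match⁻ r u eq s cs = literal-true (pat s u) _ (and-pick⁻ care _ eq s cs)

  match⁺ : ∀ r u → (∀ s → care s ≡ true → bit n r s zero ≡ pat s u) → match r u ≡ true
  match⁺ r u eq = and-pick⁺ care _ λ s cs → literal-refl (pat s u) _ (eq s cs)

  even-shift : ∀ r → even r ≡ true → ∀ s → shift r s ≡ false
  even-shift r er s = ≢true⇒≡false λ eq →
    let u , _ , hit = or-pick⁻ (adj S s) (match r) eq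
        s′ , cs′ , ps′ = pat-nonzero u
    in bit n r s′ zero , even-selector r er s′ cs′ , trans (match⁻ r u hit s′ cs′) ps′

  f-even : ∀ r → even r ≡ true → f (G r) ≡ true
  f-even r er = trans (f-G r) (cong not (≢true⇒≡false λ eq →
    let s , p = or-tabulate⁻ (shift r) eq in shift r s , even-shift r er s , p))

  -- Moves an all-even seed to the part of u, flipping bit suc j in the blocks of the sets containing u.
  moveBlock : Fin l → Fin m → Bits M → Fin n → Fin (suc l) → Bool
  moveBlock j u r s zero    = if care s then pat s u else bit n r s zero
  moveBlock j u r s (suc i) = bit n r s (suc i) xor (does (i ≟ᶠ j) ∧ adj S s u)

  move : Fin l → Fin m → Bits M → Bits M
  move j u r = fromBlocks n (moveBlock j u r)

  -- The element is absent from the arguments: `shift` recovers its neighbourhood from the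
  -- selectors, which are then reset. Thus one map undoes `move j u` for all `u`.
  unmoveBlock : Fin l → Bits M → Fin n → Fin (suc l) → Bool
  unmoveBlock j r s zero    = if care s then false else bit n r s zero
  unmoveBlock j r s (suc i) = bit n r s (suc i) xor (does (i ≟ᶠ j) ∧ shift r s)

  unmove : Fin l → Bits M → Bits M
  unmove j r = fromBlocks n (unmoveBlock j r)

  move-selector : ∀ j u r s → bit n (move j u r) s zero ≡ (if care s then pat s u else bit n r s zero)
  move-selector j u r s = bit-fromBlocks n (moveBlock j u r) s zero

  move-free : ∀ j u r s i → bit n (move j u r) s (suc i) ≡ bit n r s (suc i) xor (does (i ≟ᶠ j) ∧ adj S s u)
  move-free j u r s i = bit-fromBlocks n (moveBlock j u r) s (suc i)

  move-care : ∀ j u r s → care s ≡ true → bit n (move j u r) s zero ≡ pat s u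
  move-care j u r s cs = trans (move-selector j u r s) (cong (λ c → if c then pat s u else bit n r s zero) cs)

  -- Besides `u` the moved selectors may match another `u′`, but equal patterns on the relevant
  -- selectors force equal neighbourhoods.
  shift-move : ∀ j u r s → shift (move j u r) s ≡ adj S s u
  shift-move j u r s = ⇔⇒≡
    (λ eq → let u′ , su′ , hit = or-pick⁻ (adj S s) (match (move j u r)) eq in
       trans (pat-separates u u′ (λ s cs → trans (sym (move-care j u r s cs)) (match⁻ (move j u r) u′ hit s cs)) s) su′)
    (λ su → or-pick⁺ (adj S s) (match (move j u r)) u su (match⁺ (move j u r) u (move-care j u r)))

  unmove-move : ∀ j u r → even r ≡ true → unmove j (move j u r) ≡ r
  unmove-move j u r er = bits-ext n λ
    { s zero    → trans (bit-fromBlocks n (unmoveBlock j (move j u r)) s zero) (restore s)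
    ; s (suc i) → trans (bit-fromBlocks n (unmoveBlock j (move j u r)) s (suc i))
                    (trans (cong₂ (λ a b → a xor (does (i ≟ᶠ j) ∧ b)) (move-free j u r s i) (shift-move j u r s))
                           (xor-cancelʳ (bit n r s (suc i)) (does (i ≟ᶠ j) ∧ adj S s u))) }
    where
    restore : ∀ s → (if care s then false else bit n (move j u r) s zero) ≡ bit n r s zero
    restore s with care s in cs
    ... | true  = sym (even-selector r er s cs)
    ... | false = trans (move-selector j u r s) (cong (λ c → if c then pat s u else bit n r s zero) cs)

  G-move-free : ∀ j u r s i → bit n (G (move j u r)) s (suc i) ≡ bit n (G r) s (suc i) xor (does (i ≟ᶠ j) ∧ adj S s u)
  G-move-free j u r s i = trans (generator-free (move j u r) s i)
    (trans (move-free j u r s i) (cong (_xor (does (i ≟ᶠ j) ∧ adj S s u)) (sym (generator-free r s i))))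

  -- The change of the block parity is compensated by the flipped bit.
  G-move-selector : ∀ j u r → even r ≡ true → ∀ s → bit n (G (move j u r)) s zero ≡ bit n (G r) s zero
  G-move-selector j u r er s = begin
    bit n (G (move j u r)) s zero                               ≡⟨ generator-parity (move j u r) s ⟩
    shift (move j u r) s xor parity (λ i → bit n (move j u r) s (suc i))
      ≡⟨ cong₂ _xor_ (shift-move j u r s) (trans (parity-cong (move-free j u r s)) (parity-flip (λ i → bit n r s (suc i)) j (adj S s u))) ⟩
    adj S s u xor (P xor adj S s u)                             ≡⟨ xor-comm (adj S s u) _ ⟩
    (P xor adj S s u) xor adj S s u                             ≡⟨ xor-cancelʳ P (adj S s u) ⟩
    P                                                           ≡⟨ cong (_xor P) (even-shift r er s) ⟨
    shift r s xor P                                             ≡⟨ generator-parity r s ⟨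
    bit n (G r) s zero                                          ∎
    where
    open ≡-Reasoning
    P = parity (λ i → bit n r s (suc i))

  f-move : ∀ j u r → f (G (move j u r)) ≡ false
  f-move j u r = trans (f-G (move j u r)) (cong not
    (let s , su = coverable S u in or-tabulate⁺ (shift (move j u r)) s (trans (shift-move j u r s) su)))

  column : Term M → Fin l → Fin n → Bool
  column T j s = mentions T (combine s (suc j))

  -- The outputs of the two seeds differ only in column `j`, in the blocks of sets containing `u`,
  -- and `avoid` says that `T` mentions none of these coordinates. Literals at position 0 do no harm
  -- by `G-move-selector`.
  accepts-move : ∀ T j u r → even r ≡ true → (∀ s → column T j s ≡ true → adj S s u ≡ false) →
                 accepts (G r) T ≡ true → accepts (G (move j u r)) T ≡ true
  accepts-move T j u r er avoid acc = trans (accepts-local T (by-blocks n _ same)) acc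
    where
    same : ∀ s i → mentions T (combine s i) ≡ true → bit n (G (move j u r)) s i ≡ bit n (G r) s i
    same s zero    i∈ = G-move-selector j u r er s
    same s (suc i) i∈ with does (i ≟ᶠ j) in eq | G-move-free j u r s i
    ... | false | free = trans free (xor-identityʳ _)
    ... | true  | free = trans free (trans (cong (bit n (G r) s (suc i) xor_) (avoid s j∈)) (xor-identityʳ _))
      where j∈ = subst (λ k → mentions T (combine s (suc k)) ≡ true) (does-true {i = i} {j} eq) i∈

  -- A term restricts the coordinates it mentions; the selector coordinates are already restricted on even seeds.
  restrictedBlock : Term M → Fin n → Fin (suc l) → Bool
  restrictedBlock T s zero    = care s
  restrictedBlock T s (suc j) = column T j s

  restricted : Term M → Fin M → Bool
  restricted T = onBlocks n (restrictedBlock T)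

  width : Term M → ℕ
  width T = sum λ j → tally (column T j)

  tally-zeroMask : tally zeroMask ≡ tally care
  tally-zeroMask = trans (tally-onBlocks n zeroBlock) (sum-cong-≗ λ s → trans (cong (⟨ care s ⟩ +_) (zeros l)) (+-identityʳ _))
    where
    zeros : ∀ k → tally {k} (λ _ → false) ≡ 0
    zeros zero    = refl
    zeros (suc k) = zeros k

  tally-restricted : ∀ T → tally (restricted T) ≡ tally care + width T
  tally-restricted T = trans (tally-onBlocks n (restrictedBlock T)) (trans (∑-distrib-+ (λ s → ⟨ care s ⟩) (λ s → tally λ j → column T j s))
    (cong (tally care +_) (∑-comm λ s j → ⟨ column T j s ⟩)))

  evenAccepting : Term M → Bits M → Bool
  evenAccepting T r = even r ∧ accepts (G r) T

  -- Free seed bits are copied to the output, so each mentioned free coordinate fixes one more seed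
  -- bit. Accepted even seeds thus lie in a subcube fixing `tally care + width T` bits, while the
  -- even seeds fill one fixing only `tally care`.
  evenAccepting-count : ∀ T → count (evenAccepting T) * 2 ^ width T ≤ count even
  evenAccepting-count T = *-cancelʳ-≤ _ _ (2 ^ tally care) {{m^n≢0 2 (tally care)}} (begin
    count (evenAccepting T) * 2 ^ width T * 2 ^ tally care     ≡⟨ *-assoc (count (evenAccepting T)) _ _ ⟩
    count (evenAccepting T) * (2 ^ width T * 2 ^ tally care)   ≡⟨ cong (count (evenAccepting T) *_) (trans (cong (2 ^_) (tally-restricted T))
                                                                   (trans (^-distribˡ-+-* 2 (tally care) (width T)) (*-comm (2 ^ tally care) _))) ⟨
    count (evenAccepting T) * 2 ^ tally (restricted T)         ≤⟨ count-agreeing (evenAccepting T) (restricted T) agree ⟩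
    2 ^ M                                                      ≤⟨ vanishing-count zeroMask ⟩
    count even * 2 ^ tally zeroMask                            ≡⟨ cong (λ t → count even * 2 ^ t) tally-zeroMask ⟩
    count even * 2 ^ tally care                                ∎)
    where
    open ≤-Reasoning
    agree : ∀ r r′ → evenAccepting T r ≡ true → evenAccepting T r′ ≡ true → ∀ i → restricted T i ≡ true → lookup r i ≡ lookup r′ i
    agree r r′ Er Er′ = by-blocks n _ same
      where
      same : ∀ s i → restricted T (combine s i) ≡ true → bit n r s i ≡ bit n r′ s i
      same s zero i∈ = trans (even-selector r (proj₁ (∧-true Er)) s cs) (sym (even-selector r′ (proj₁ (∧-true Er′)) s cs))
        where cs = trans (sym (onBlocks-combine n (restrictedBlock T) s zero)) i∈
      same s (suc j) i∈ = trans (sym (generator-free r s j)) (trans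
        (accepts-agree T (proj₂ (∧-true {even r} Er)) (proj₂ (∧-true {even r′} Er′)) (combine s (suc j)) (trans (sym (onBlocks-combine n (restrictedBlock T) s (suc j))) i∈))
        (generator-free r′ s j))

  -- Hardness for small DNFs when every cover is large

  module Hardness (k′ : ℕ) (hard : ∀ C → IsCover S C → k′ < ∣ C ∣) where
    uncovered : (D : Fin n → Bool) → tally D ≤ k′ → ∃[ u ] (∀ s → D s ≡ true → adj S s u ≡ false)
    uncovered D small =
      let u , miss = ¬∀⟶∃¬ m Covered (λ u → any? λ s → (D s ≟ true) ×-dec (adj S s u ≟ true)) not-cover
      in u , λ s Ds → ¬-not λ su → miss (s , Ds , su)
      where
      Covered : Fin m → Set
      Covered u = ∃[ s ] D s ≡ true × adj S s u ≡ true
      not-cover : ¬ (∀ u → Covered u)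
      not-cover covered = <⇒≱ (hard (Vec.tabulate D) λ u → let s , Ds , su = covered u in
          s , Vec.lookup⇒[]= s (Vec.tabulate D) (trans (Vec.lookup∘tabulate D s) Ds) , su)
        (subst (_≤ k′) (sym (tally-tabulate D)) small)

    light : Term M → Fin l → Bool
    light T j = tally (column T j) ≤ᵇ k′

    thin : Term M → Bool
    thin T = l ≤ᵇ 2 * tally (light T)

    -- Markov: most columns of a term of small width are light.
    wide-width : ∀ T → thin T ≡ false → suc l * suc k′ ≤ 2 * width T
    wide-width T wide = +-cancelʳ-≤ (2 * t * c) (suc l * c) (2 * width T) (begin
      suc l * c + 2 * t * c               ≡⟨ rearrange₁ l (2 * t) c ⟩
      -- The strict inequality `2 * t < l` supplies the extra row that turns `l` into the full block
      -- length `suc l`.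
      l * c + suc (2 * t) * c             ≤⟨ +-monoʳ-≤ (l * c) (*-monoˡ-≤ c 2t<l) ⟩
      l * c + l * c                       ≤⟨ +-mono-≤ columns columns ⟩
      (width T + t * c) + (width T + t * c) ≡⟨ rearrange₂ (width T) t c ⟩
      2 * width T + 2 * t * c             ∎)
      where
      open ≤-Reasoning
      t = tally (light T)
      c = suc k′
      rearrange₁ : ∀ l t c → suc l * c + t * c ≡ l * c + suc t * c
      rearrange₁ = solve-∀
      rearrange₂ : ∀ w t c → (w + t * c) + (w + t * c) ≡ 2 * w + 2 * t * c
      rearrange₂ = solve-∀
      2t<l : 2 * t < l
      2t<l = ≰⇒> λ le → case-true (trans (sym (T⇒≡ (≤⇒≤ᵇ le))) wide)
        where
        case-true : true ≢ false
        case-true ()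
      -- Crediting light columns with `c` lets every column contribute at least `c`; the credits
      -- total `t * c`.
      heavy : ∀ j → c ≤ tally (column T j) + ⟨ light T j ⟩ * c
      heavy j with light T j in eq
      ... | true  = ≤-trans (≤-reflexive (sym (*-identityˡ c))) (m≤n+m (1 * c) _)
      ... | false = ≤-trans (≰⇒> λ le → case-true (trans (sym (T⇒≡ (≤⇒≤ᵇ le))) eq)) (m≤m+n _ 0)
        where
        case-true : true ≢ false
        case-true ()
      columns : l * c ≤ width T + t * c
      columns = begin
        l * c                                                     ≤⟨ sum-bounded-below _ c heavy ⟩
        sum (λ j → tally (column T j) + ⟨ light T j ⟩ * c)        ≡⟨ ∑-distrib-+ (λ j → tally (column T j)) (λ j → ⟨ light T j ⟩ * c) ⟩
        width T + sum (λ j → ⟨ light T j ⟩ * c)                   ≡⟨ cong (width T +_) (sum-*ʳ (λ j → ⟨ light T j ⟩) c) ⟩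
        width T + t * c                                           ∎

    module _ (φ : DNF M) (1≤l : 1 ≤ l) (small : length φ * length φ ≤ 2 ^ (k′ * suc l)) where
      error : Bits M → Bool
      error r = evalDNF φ (G r) xor f (G r)

      -- Both hypotheses concern squares: `small` bounds the square of the number of terms, and
      -- `wide-width` bounds twice the width. Hence the comparison of squares.
      wide-bound : ∀ T → thin T ≡ false → 2 * length φ ≤ 2 ^ width T
      wide-bound T wide = n²≤m²⇒n≤m _ _ (begin
        2 * length φ * (2 * length φ)       ≡⟨ rearrange (length φ) ⟩
        4 * (length φ * length φ)           ≤⟨ *-monoʳ-≤ 4 small ⟩
        2 ^ 2 * 2 ^ (k′ * suc l)            ≡⟨ ^-distribˡ-+-* 2 2 (k′ * suc l) ⟨
        -- The factor 4 is absorbed by the surplus `suc l` of `suc l * suc k′` over `suc l * k′`;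
        -- here the block length must be at least 2.
        2 ^ (2 + k′ * suc l)                ≤⟨ ^-monoʳ-≤ 2 (+-mono-≤ (s≤s 1≤l) (≤-reflexive (*-comm k′ (suc l)))) ⟩
        2 ^ (suc l + suc l * k′)            ≡⟨ cong (2 ^_) (*-suc (suc l) k′) ⟨
        2 ^ (suc l * suc k′)                ≤⟨ ^-monoʳ-≤ 2 (wide-width T wide) ⟩
        2 ^ (2 * width T)                   ≡⟨ cong (2 ^_) (cong (width T +_) (+-identityʳ (width T))) ⟩
        2 ^ (width T + width T)             ≡⟨ ^-distribˡ-+-* 2 (width T) (width T) ⟩
        2 ^ width T * 2 ^ width T           ∎)
        where
        open ≤-Reasoning
        rearrange : ∀ s → 2 * s * (2 * s) ≡ 4 * (s * s)
        rearrange = solve-∀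

      wideTerm : Term M → Bits M → Bool
      wideTerm T r = not (thin T) ∧ evenAccepting T r

      byWide byThin : Bits M → Bool
      byWide r = any (λ T → wideTerm T r) φ
      byThin r = even r ∧ any (λ T → thin T ∧ accepts (G r) T) φ

      wideTerm-count : ∀ T → count (wideTerm T) * (2 * length φ) ≤ count even
      wideTerm-count T with thin T in eq
      ... | true  = subst (λ c → c * (2 * length φ) ≤ count even) (sym (unsatisfiable (λ (_ : Bits M) → false) λ _ ())) z≤n
      ... | false = ≤-trans (*-monoʳ-≤ (count (evenAccepting T)) (wide-bound T eq)) (evenAccepting-count T)

      byWide-count : 2 * count byWide ≤ count even
      byWide-count = half φ refl
        where
        half : ∀ ψ → φ ≡ ψ → 2 * count byWide ≤ count even
        -- The union bound is divided by `length φ`, so the empty DNF is treated apart.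
        half [] eq = subst (λ c → 2 * c ≤ count even) (sym (unsatisfiable byWide none)) z≤n
          where
          none : ∀ r → byWide r ≢ true
          none r p with () ← trans (sym p) (cong (any (λ T → wideTerm T r)) eq)
        half (T ∷ ψ) eq = *-cancelˡ-≤ (length φ) {{subst (λ χ → NonZero (length χ)) (sym eq) _}} (begin
          length φ * (2 * count byWide)     ≡⟨ rearrange (length φ) (count byWide) ⟩
          count byWide * (2 * length φ)     ≤⟨ count-any wideTerm (2 * length φ) (count even) φ wideTerm-count ⟩
          length φ * count even             ∎)
          where
          open ≤-Reasoning
          rearrange : ∀ s c → s * (2 * c) ≡ c * (2 * s)
          rearrange = solve-∀

      lightly : Fin l → Bits M → Bool
      lightly j r = even r ∧ any (λ T → light T j ∧ accepts (G r) T) φ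

      -- The moved seed is an error because the term still accepts while `f` has become false. Term
      -- and element vary with the seed, but `unmove j` recovers the seed without them, so distinct
      -- seeds yield distinct errors.
      lightly-count : ∀ j → count (lightly j) ≤ count error
      lightly-count j = count-surjection (lightly j) error (unmove j) λ r Lr →
        let er , hit = ∧-true {even r} Lr
            T , lit , up = any⁻ (λ T → light T j ∧ accepts (G r) T) φ hit
            isLight , acc = ∧-true {light T j} lit
            u , avoid = uncovered (column T j) (≤ᵇ⇒≤ _ _ (≡⇒T isLight))
        in move j u r ,
           trans (cong₂ _xor_ (up (accepts (G (move j u r))) (accepts-move T j u r er avoid acc)) (f-move j u r)) refl ,
           unmove-move j u r er

      -- A thin term is light in at least half of the columns, so each such seed is counted by
      -- `lightly` for at least `l / 2` columns; this halving is the factor 2.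
      byThin-count : count byThin ≤ 2 * count error
      byThin-count = count-doubleCount {{>-nonZero 1≤l}} byThin lightly (count error) many lightly-count
        where
        many : ∀ r → byThin r ≡ true → l ≤ 2 * tally (λ j → lightly j r)
        many r Br =
          let er , hit = ∧-true {even r} Br
              T , both , up = any⁻ (λ T → thin T ∧ accepts (G r) T) φ hit
              isThin , acc = ∧-true {thin T} both
          in ≤-trans (≤ᵇ⇒≤ _ _ (≡⇒T isThin)) (*-monoʳ-≤ 2 (tally-mono {p = light T} λ j lt →
               cong₂ _∧_ er (up (λ T → light T j ∧ accepts (G r) T) (cong₂ _∧_ lt acc))))

      split : ∀ r → even r ≡ true → evalDNF φ (G r) ≡ true → byWide r ≡ true ⊎ byThin r ≡ true
      split r er acc with any⁻ (accepts (G r)) φ acc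
      ... | T , accT , up with thin T in eq
      ...   | true  = inj₂ (cong₂ _∧_ er (up (λ T → thin T ∧ accepts (G r) T) (cong₂ _∧_ eq accT)))
      ...   | false = inj₁ (up (λ T → wideTerm T r) (cong₂ _∧_ (cong not eq) (cong₂ _∧_ er accT)))

      even-cases : ∀ r → even r ≡ true → error r ≡ true ⊎ byWide r ≡ true ⊎ byThin r ≡ true
      even-cases r er with evalDNF φ (G r) in eq
      ... | false = inj₁ (f-even r er)
      ... | true  = inj₂ (split r er eq)

      -- An even seed is rejected, which is an error, or accepted through a wide or a thin term. So
      -- `even ≤ error + even / 2 + 2 * error`, doubled to avoid the fraction.
      even-count : count even ≤ 6 * count error
      even-count = +-cancelˡ-≤ (count even) _ _ (begin
        count even + count even                                    ≡⟨ cong (count even +_) (+-identityʳ (count even)) ⟨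
        2 * count even                                             ≤⟨ *-monoʳ-≤ 2 union ⟩
        2 * (count error + (count byWide + count byThin))          ≡⟨ rearrange₁ (count error) (count byWide) (count byThin) ⟩
        2 * count byWide + (2 * count error + 2 * count byThin)    ≤⟨ +-mono-≤ byWide-count (+-monoʳ-≤ (2 * count error) (*-monoʳ-≤ 2 byThin-count)) ⟩
        count even + (2 * count error + 2 * (2 * count error))     ≡⟨ cong (count even +_) (rearrange₂ (count error)) ⟩
        count even + 6 * count error                               ∎)
        where
        open ≤-Reasoning
        rearrange₁ : ∀ e w t → 2 * (e + (w + t)) ≡ 2 * w + (2 * e + 2 * t)
        rearrange₁ = solve-∀
        rearrange₂ : ∀ e → 2 * e + 2 * (2 * e) ≡ 6 * e
        rearrange₂ = solve-∀
        ⟨⟩-cover : ∀ {b} c d e → (b ≡ true → c ≡ true ⊎ d ≡ true ⊎ e ≡ true) → ⟨ b ⟩ ≤ ⟨ c ⟩ + (⟨ d ⟩ + ⟨ e ⟩)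
        ⟨⟩-cover {false} c d e h = z≤n
        ⟨⟩-cover {true} c d e h with h refl
        ... | inj₁ refl        = m≤m+n 1 _
        ... | inj₂ (inj₁ refl) = ≤-trans (m≤m+n 1 _) (m≤n+m _ ⟨ c ⟩)
        ... | inj₂ (inj₂ refl) = ≤-trans (m≤n+m 1 ⟨ d ⟩) (m≤n+m _ ⟨ c ⟩)
        union : count even ≤ count error + (count byWide + count byThin)
        union = begin
          count even                                     ≡⟨ count-total even ⟩
          total (λ r → ⟨ even r ⟩)                       ≤⟨ total-mono (λ r → ⟨⟩-cover (error r) (byWide r) (byThin r) (even-cases r)) ⟩
          total (λ r → ⟨ error r ⟩ + (⟨ byWide r ⟩ + ⟨ byThin r ⟩))
            ≡⟨ trans (total-+ _ (λ r → ⟨ byWide r ⟩ + ⟨ byThin r ⟩)) (cong (total (λ r → ⟨ error r ⟩) +_) (total-+ _ (λ r → ⟨ byThin r ⟩))) ⟩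
          total (λ r → ⟨ error r ⟩) + (total (λ r → ⟨ byWide r ⟩) + total (λ r → ⟨ byThin r ⟩))
            ≡⟨ cong₂ _+_ (count-total error) (cong₂ _+_ (count-total byWide) (count-total byThin)) ⟨
          count error + (count byWide + count byThin)    ∎

      -- The factor 12 combines 6 from `even-count` with 2 from the rounding of the code length.
      -- Passing to 13 gives a strict inequality, since positivity of `2 ^ M` excludes a zero error
      -- count.
      far-count : ∀ N → 2 ^ tally care ≤ 2 * N → 2 ^ M < count error * (13 * N)
      far-count N care≤ = begin-strict
        2 ^ M                       <⟨ positive (count error * N) (m^n>0 2 M) (begin
          2 ^ M                       ≤⟨ vanishing-count zeroMask ⟩
          count even * 2 ^ tally zeroMask ≡⟨ cong (λ t → count even * 2 ^ t) tally-zeroMask ⟩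
          count even * 2 ^ tally care ≤⟨ *-mono-≤ even-count care≤ ⟩
          6 * count error * (2 * N)   ≡⟨ rearrange₁ (count error) N ⟩
          12 * (count error * N)      ∎) ⟩
        13 * (count error * N)      ≡⟨ rearrange₂ (count error) N ⟩
        count error * (13 * N)      ∎
        where
        open ≤-Reasoning
        rearrange₁ : ∀ e N → 6 * e * (2 * N) ≡ 12 * (e * N)
        rearrange₁ = solve-∀
        rearrange₂ : ∀ e N → 13 * (e * N) ≡ e * (13 * N)
        rearrange₂ = solve-∀
        positive : ∀ x {y} → 0 < y → y ≤ 12 * x → y < 13 * x
        positive zero    0<y y≤0 = ⊥-elim (<⇒≱ 0<y y≤0)
        positive (suc x) 0<y y≤  = s≤s (≤-trans y≤ (m≤n+m _ x))

-- Separation by binary codes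

value : List Bool → ℕ
value []      = 0
value (b ∷ l) = ⟨ b ⟩ + 2 * value l

value-inc : ∀ l → value (inc l) ≡ suc (value l)
value-inc []          = refl
value-inc (false ∷ l) = refl
value-inc (true ∷ l)  = trans (cong (2 *_) (value-inc l)) (*-suc 2 (value l))

value-bin : ∀ k → value (bin k) ≡ k
value-bin zero    = refl
value-bin (suc k) = trans (value-inc (bin k)) (cong suc (value-bin k))

-- Lists of different lengths can have equal bits because `bitAt` reads zeros past the end, so
-- values are compared instead of lists.
value-cong : ∀ b {l l′} → length l ≤ b → length l′ ≤ b → (∀ k → k < b → bitAt l k ≡ bitAt l′ k) → value l ≡ value l′
value-cong b       {[]}    {[]}     p q eq = refl
value-cong (suc b) {[]}    {y ∷ l′} p q eq = cong₂ (λ c v → ⟨ c ⟩ + 2 * v) (eq 0 (s≤s z≤n))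
  (value-cong b {[]} {l′} z≤n (s≤s⁻¹ q) λ k k<b → eq (suc k) (s≤s k<b))
value-cong (suc b) {x ∷ l} {[]}     p q eq = cong₂ (λ c v → ⟨ c ⟩ + 2 * v) (eq 0 (s≤s z≤n))
  (value-cong b {l} {[]} (s≤s⁻¹ p) z≤n λ k k<b → eq (suc k) (s≤s k<b))
value-cong (suc b) {x ∷ l} {y ∷ l′} p q eq = cong₂ (λ c v → ⟨ c ⟩ + 2 * v) (eq 0 (s≤s z≤n))
  (value-cong b {l} {l′} (s≤s⁻¹ p) (s≤s⁻¹ q) λ k k<b → eq (suc k) (s≤s k<b))

inc-length : ∀ l → length l ≤ length (inc l)
inc-length []          = z≤n
inc-length (false ∷ l) = ≤-refl
inc-length (true ∷ l)  = s≤s (inc-length l)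

bin-length-mono : ∀ {j k} → j ≤ k → length (bin j) ≤ length (bin k)
bin-length-mono {j} {k} j≤k with m≤n⇒m<n∨m≡n j≤k
... | inj₂ refl = ≤-refl
bin-length-mono {j} {suc k} _ | inj₁ j<k = ≤-trans (bin-length-mono (s≤s⁻¹ j<k)) (inc-length (bin k))

inc-bit : ∀ l → ∃[ k ] k < length (inc l) × bitAt (inc l) k ≡ true
inc-bit []          = 0 , s≤s z≤n , refl
inc-bit (false ∷ l) = 0 , s≤s z≤n , refl
inc-bit (true ∷ l)  = let k , k< , eq = inc-bit l in suc k , s≤s k< , eq

-- The length grows only when a power of two is reached.
inc-size : ∀ l → 2 ^ length (inc l) ≤ 2 ^ length l ⊎ 2 ^ length (inc l) ≡ 2 * value (inc l)
inc-size []          = inj₂ refl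
inc-size (false ∷ l) = inj₁ ≤-refl
inc-size (true ∷ l)  with inc-size l
... | inj₁ p = inj₁ (*-monoʳ-≤ 2 p)
... | inj₂ p = inj₂ (cong (2 *_) p)

bin-size : ∀ k → 2 ^ length (bin (suc k)) ≤ 2 * suc k
bin-size k with inc-size (bin k)
... | inj₂ p = ≤-reflexive (trans p (cong (2 *_) (value-bin (suc k))))
bin-size zero    | inj₁ p = ≤-trans p (m≤n+m 1 1)
bin-size (suc k) | inj₁ p = ≤-trans p (≤-trans (bin-size k) (*-monoʳ-≤ 2 (n≤1+n (suc k))))

tally-<ᵇ : ∀ n b → tally {n} (λ s → toℕ s <ᵇ b) ≤ b
tally-<ᵇ zero    b       = z≤n
tally-<ᵇ (suc n) zero    = tally-<ᵇ n zero
tally-<ᵇ (suc n) (suc b) = s≤s (tally-<ᵇ n b)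

<ᵇ-true : ∀ {a b} → a < b → (a <ᵇ b) ≡ true
<ᵇ-true p = T⇒≡ (<⇒<ᵇ p)

<ᵇ-true⁻¹ : ∀ a b → (a <ᵇ b) ≡ true → a < b
<ᵇ-true⁻¹ a b p = <ᵇ⇒< a b (≡⇒T p)

<ᵇ-false⁻¹ : ∀ a b → (a <ᵇ b) ≡ false → b ≤ a
<ᵇ-false⁻¹ a b p = ≮⇒≥ λ a<b → clash (trans (sym (<ᵇ-true a<b)) p)
  where
  clash : true ≢ false
  clash ()

module CodeProperties (S : Instance) (l : ℕ) where
  open Code S l

  b : ℕ
  b = length (bin m)

  all-care : (n <ᵇ b) ≡ true → ∀ s → care s ≡ true
  all-care eq s = <ᵇ-true (<-trans (toℕ<n s) (<ᵇ-true⁻¹ n b eq))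

  code-length : ∀ u → length (bin (suc (toℕ {m} u))) ≤ b
  code-length u = bin-length-mono (toℕ<n u)

  -- Where patterns are neighbourhoods, `coverable` gives a set containing `u`. Otherwise the code
  -- is that of `u + 1`, which has a nonzero digit, and `b ≤ n` ensures that a selector carries it.
  pat-nonzero : ∀ u → ∃[ s ] care s ≡ true × pat s u ≡ true
  pat-nonzero u with n <ᵇ b in eq
  ... | true  = let s , su = coverable S u in s , all-care eq s , su
  ... | false =
    let k , k<len , bit = inc-bit (bin (toℕ u))
        k<b = ≤-trans k<len (code-length u)
        k<n = ≤-trans k<b (<ᵇ-false⁻¹ n b eq)
    in fromℕ< k<n , <ᵇ-true (subst (_< b) (sym (toℕ-fromℕ< k<n)) k<b) , trans (cong (bitAt (bin (suc (toℕ u)))) (toℕ-fromℕ< k<n)) bit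

  pat-separates : ∀ u u′ → (∀ s → care s ≡ true → pat s u ≡ pat s u′) → ∀ s → adj S s u ≡ adj S s u′
  pat-separates u u′ same s with n <ᵇ b in eq
  ... | true  = same s (all-care eq s)
  ... | false = cong (adj S s) (toℕ-injective (suc-injective (begin
    suc (toℕ u)                    ≡⟨ value-bin (suc (toℕ u)) ⟨
    value (bin (suc (toℕ u)))      ≡⟨ value-cong b {bin (suc (toℕ u))} {bin (suc (toℕ u′))} (code-length u) (code-length u′) bits ⟩
    value (bin (suc (toℕ u′)))     ≡⟨ value-bin (suc (toℕ u′)) ⟩
    suc (toℕ u′)                   ∎)))
    where
    open ≡-Reasoning
    bits : ∀ k → k < b → bitAt (bin (suc (toℕ u))) k ≡ bitAt (bin (suc (toℕ u′))) k
    bits k k<b = subst (λ j → bitAt (bin (suc (toℕ u))) j ≡ bitAt (bin (suc (toℕ u′))) j) (toℕ-fromℕ< k<n)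
      (same (fromℕ< k<n) (<ᵇ-true (subst (_< b) (sym (toℕ-fromℕ< k<n)) k<b)))
      where k<n = ≤-trans k<b (<ᵇ-false⁻¹ n b eq)

  care-size : .{{_ : NonZero (∣V∣ S)}} → 2 ^ tally care ≤ 2 * ∣V∣ S
  care-size = ≤-trans (^-monoʳ-≤ 2 (tally-<ᵇ n b)) (bound m refl)
    where
    bound : ∀ k → k ≡ m → 2 ^ length (bin k) ≤ 2 * ∣V∣ S
    -- Without elements the code length is 0 and the claim is `1 ≤ 2 * N`; `bin-size` covers
    -- positive `m`.
    bound zero    _    = ≤-trans (n≤1+n 1) (*-monoʳ-≤ 2 (>-nonZero⁻¹′ (∣V∣ S)))
      where
      >-nonZero⁻¹′ : ∀ k → .{{_ : NonZero k}} → 1 ≤ k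
      >-nonZero⁻¹′ (suc k) = s≤s z≤n
    bound (suc k) refl = ≤-trans (bin-size k) (*-monoʳ-≤ 2 (m≤n+m (suc k) n))

-- k and k′ are unbounded in terms of N, so they are discarded without being copied.
reductionProgram : Cmd 1
reductionProgram = zero ≔ cons (hd (var zero)) (hd (tl (var zero))) ⨾ call zero (prog reductionF) (var zero)

-- These follow the encoding with `X` the number of vertices: a unary `k` has size `1 + 2k`, a bit
-- at most 3, and every list cell adds 1.
unaryPoly matrixPoly inputPoly timePoly : Poly
unaryPoly  = K 1 ⊕ X ⊗ K 2
matrixPoly = K 1 ⊕ X ⊗ (K 1 ⊕ (K 1 ⊕ X ⊗ K 4))
inputPoly  = K 1 ⊕ (K 1 ⊕ (unaryPoly ⊕ (K 1 ⊕ (unaryPoly ⊕ matrixPoly))) ⊕ unaryPoly)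
timePoly   = (K 1 ⊕ X ⊕ (K 1 ⊕ X ⊕ cost reductionF ⊕ cost reductionF)) ∘ₚ inputPoly

size-unary : ∀ k → size (unary k) ≡ 1 + k * 2
size-unary zero    = refl
size-unary (suc k) = cong (2 +_) (size-unary k)

size-tabulate : ∀ {k} (g : Fin k → Tree) c → (∀ i → size (g i) ≤ c) → size (encodeList (tabulate g)) ≤ 1 + k * suc c
size-tabulate {zero}  g c bound = ≤-refl
size-tabulate {suc k} g c bound = s≤s (≤-trans (+-mono-≤ (bound zero) (size-tabulate (g ∘ suc) c (bound ∘ suc)))
  (≤-reflexive (+-suc c (k * suc c))))

size-input : ∀ S ℓ → ℓ ≤ ∣V∣ S → size (encodeInstance S ∙ unary ℓ) ≤ evalPoly inputPoly (∣V∣ S)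
size-input S ℓ ℓ≤N = s≤s (+-mono-≤ (s≤s (+-mono-≤ (unary≤ n≤N) (s≤s (+-mono-≤ (unary≤ m≤N) matrix≤)))) (unary≤ ℓ≤N))
  where
  N : ℕ
  N = ∣V∣ S
  n≤N : #sets S ≤ N
  n≤N = m≤m+n (#sets S) (#elems S)
  m≤N : #elems S ≤ N
  m≤N = m≤n+m (#elems S) (#sets S)
  unary≤ : ∀ {k} → k ≤ N → size (unary k) ≤ evalPoly unaryPoly N
  unary≤ {k} k≤N = ≤-trans (≤-reflexive (size-unary k)) (s≤s (*-monoˡ-≤ 2 k≤N))
  bool≤ : ∀ b → size (encodeBool b) ≤ 3
  bool≤ true  = ≤-refl
  bool≤ false = s≤s z≤n
  matrix≤ : size (encodeList (tabulate (Code.row S 0))) ≤ evalPoly matrixPoly N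
  matrix≤ = ≤-trans (size-tabulate (Code.row S 0) (1 + N * 4) λ u →
      ≤-trans (size-tabulate (λ s → encodeBool (adj S s u)) 3 λ s → bool≤ (adj S s u)) (s≤s (*-monoˡ-≤ 4 n≤N)))
    (s≤s (*-monoˡ-≤ (2 + N * 4) m≤N))

reductionProgram-runs : ∀ S k k′ l → suc l ≤ ∣V∣ S →
  ∃[ t ] Runs reductionProgram (encodeInput S k k′ (suc l)) (encodeOutput (tester (#sets S) (suc l)) (Code.generator S l)) t
         × t ≤ evalPoly timePoly (∣V∣ S)
reductionProgram-runs S k k′ l ℓ≤N =
  let x = encodeInstance S ∙ unary (suc l)
      t , (_ , r) , t≤ = runs reductionF x
      y = ⟦ reductionF ⟧ x
      T = K 1 ⊕ X ⊕ (K 1 ⊕ X ⊕ cost reductionF ⊕ cost reductionF)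
  in _ , subst (λ z → Runs reductionProgram (encodeInput S k k′ (suc l)) z (suc (size x) + suc (size x + t + size y)))
               (Code.reduction-correct S l) (_ , seq assign (call r)) ,
     ≤-trans (+-monoʳ-≤ (suc (size x)) (s≤s (+-mono-≤ (+-monoʳ-≤ (size x) t≤) (small reductionF x))))
             (evalPoly-mono T (size-input S (suc l) ℓ≤N))

-- `mkℚᵘ` takes the denominator minus one. For `half`, `AtMostExp s half x` reads
-- `s ^ 2 ≤ 2 ^ (1 * x)`, the form needed for comparison with a width of about half of
-- `(k′ + 1) * ℓ`.
half thirteenth : ℚᵘ
half       = mkℚᵘ (ℤ.+ 1) 1
thirteenth = mkℚᵘ (ℤ.+ 1) 12

positive : ∀ d → 0ℚᵘ ℚ.< mkℚᵘ (ℤ.+ 1) d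
positive d = *<* (ℤ.+<+ (s≤s z≤n))

<-fraction : ∀ c P N .{{_ : NonZero P}} .{{_ : NonZero N}} → P < c * (13 * N) → thirteenth ℚ.* (ℤ.+ 1 / N) ℚ.< ℤ.+ c / P
<-fraction c (suc P) (suc N) P<cN = *<* (subst₂ ℤ._<_ (sym (ℤ.*-identityˡ (ℤ.+ suc P))) (ℤ.pos-* c (13 * suc N)) (ℤ.+<+ P<cN))

module Correctness (S : Instance) (l : ℕ) .{{_ : NonZero (∣V∣ S)}} where
  open Code S l
  open CodeProperties S l
  module R = Reduction S l pat care pat-nonzero pat-separates

  far : ∀ o → IsOpt S o → ∀ k′ → k′ < o → 2 ≤ suc l → (φ : DNF (#sets S * suc l)) → AtMostExp (length φ) half (k′ * suc l) →
        Far (eval generator) (thirteenth ℚ.* (ℤ.+ 1 / ∣V∣ S)) (evalDNF φ) (eval₁ (tester (#sets S) (suc l)))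
  far o (_ , minimal) k′ k′<o 2≤ℓ φ small =
    -- `2 ≤ suc l` becomes `1 ≤ l`: there is a free column in which bits can be flipped.
    <-fraction (count (H.error φ (s≤s⁻¹ 2≤ℓ) small′)) (2 ^ M) (∣V∣ S) {{m^n≢0 2 M}} (H.far-count φ (s≤s⁻¹ 2≤ℓ) small′ (∣V∣ S) care-size)
    where
    module H = R.Hardness k′ (λ C cover → <-≤-trans k′<o (minimal C cover))
    small′ : length φ * length φ ≤ 2 ^ (k′ * suc l)
    small′ = subst₂ _≤_ (cong (length φ *_) (*-identityʳ (length φ))) (cong (2 ^_) (*-identityˡ (k′ * suc l))) small

open import Data.Integer.Base using (+_)

lemma3p1 : ∃[ r ] Σ[ p ∈ Cmd (suc r) ]
    Σ[ a ∈ ℕ ] Σ[ d ∈ ℕ ]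
    Σ[ c₁ ∈ ℚᵘ ] Σ[ c₂ ∈ ℚᵘ ] (0ℚᵘ ℚ.< c₁) × (0ℚᵘ ℚ.< c₂) ×
    ((S : Instance) (k k′ ℓ : ℕ) → .{{_ : NonZero ℓ}} → .{{_ : NonZero (∣V∣ S)}} →
    ℓ ≤ ∣V∣ S →
    Σ[ f ∈ Circuit (#sets S * ℓ) 1 ]
    Σ[ G ∈ Circuit (#sets S * ℓ) (#sets S * ℓ) ]
    (∃[ t ] Runs p (encodeInput S k k′ ℓ) (encodeOutput f G) t × t ≤ a * ∣V∣ S ^ d)
    × ((o : ℕ) → IsOpt S o →
    (o ≤ k → JuntaUnder (eval G) (k * ℓ) (eval₁ f))
    × (k′ < o → 2 ≤ ℓ →
    (φ : DNF (#sets S * ℓ)) → AtMostExp (length φ) c₁ (k′ * ℓ) →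
    Far (eval G) (c₂ ℚ.* ((+ 1) / ∣V∣ S)) (evalDNF φ) (eval₁ f))))
lemma3p1 = 0 , reductionProgram , proj₁ bound , proj₁ (proj₂ bound) , half , thirteenth , positive 1 , positive 12 , reduce
  where
  bound : ∃[ a ] ∃[ d ] (∀ n → 1 ≤ n → evalPoly timePoly n ≤ a * n ^ d)
  bound = monomial-bound timePoly
  reduce : (S : Instance) (k k′ ℓ : ℕ) → .{{_ : NonZero ℓ}} → .{{_ : NonZero (∣V∣ S)}} → ℓ ≤ ∣V∣ S →
    Σ[ f ∈ Circuit (#sets S * ℓ) 1 ] Σ[ G ∈ Circuit (#sets S * ℓ) (#sets S * ℓ) ]
    (∃[ t ] Runs reductionProgram (encodeInput S k k′ ℓ) (encodeOutput f G) t × t ≤ proj₁ bound * ∣V∣ S ^ proj₁ (proj₂ bound))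
    × ((o : ℕ) → IsOpt S o →
    (o ≤ k → JuntaUnder (eval G) (k * ℓ) (eval₁ f))
    × (k′ < o → 2 ≤ ℓ →
    (φ : DNF (#sets S * ℓ)) → AtMostExp (length φ) half (k′ * ℓ) →
    Far (eval G) (thirteenth ℚ.* ((+ 1) / ∣V∣ S)) (evalDNF φ) (eval₁ f)))
  reduce S k k′ zero {{nz}} ℓ≤N = ⊥-elim-irr (NonZero.nonZero nz)
  reduce S k k′ (suc l) ℓ≤N =
    let t , r , t≤ = reductionProgram-runs S k k′ l ℓ≤N in
    tester (#sets S) (suc l) , Code.generator S l ,
    (t , r , ≤-trans t≤ (proj₂ (proj₂ bound) (∣V∣ S) (≤-trans (s≤s z≤n) ℓ≤N))) ,
    λ o opt → (λ o≤k → let C , cover , C≡o = proj₁ opt in Correctness.R.junta S l C k cover (≤-trans (≤-reflexive C≡o) o≤k)) ,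
              (λ k′<o 2≤ℓ φ small → Correctness.far S l o opt k′ k′<o 2≤ℓ φ small)
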